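{- Let $G$ be a complete graph on $n$ vertices whose edges are labeled ``$+$'' or ``$-$''. For any $Q>0$, Algorithm Non-adaptive $\textsc{QECC}$ run on $G$ with budget $Q$ makes at most $Q$ non-adaptive edge queries and finds a clustering of $G$ with expected cost at most $3\cdot\mathrm{OPT}+\frac{n^3}{2Q}$, where $\mathrm{OPT}$ is the minimum cost of a clustering of $G$. It runs in time $O(Q)$ assuming unit-cost queries.
   Context: Correlation clustering: the input is $V=[n]$ and a complete graph on $V$ with edges labeled ``$+$'' or ``$-$''; $s(x,y)=1$ iff $\{x,y\}$ is a ``$+$'' edge. A clustering is a function $\ell:V\to\mathbb{N}$; its cost is $\sum_{\{x,y\}:\ell(x)=\ell(y)}(1-s(x,y))+\sum_{\{x,y\}:\ell(x)\neq\ell(y)}s(x,y)$, and $\mathrm{OPT}$ is the minimum cost. The algorithm learns $s(x,y)$ only by querying the pair; queries are non-adaptive if they are all specified before any answer is seen. $\Gamma^+(v)$ is the set of vertices joined to $v$ by a ``$+$'' edge. Algorithm Non-adaptive $\textsc{QECC}$ (budget $Q$): let $k=\max\{t\le n : (2n-1-t)t\le 2Q\}$. Let $S=(s_1,\ldots,s_k)$ be a uniform random sample from $V$ (with or without replacement). Querying phase: query every pair $\{v,w\}$ with $v\in S$, $w\in V$, $w\neq v$ (each unordered pair once), thereby learning $\Gamma^+(v)$ for each $v\in S$. Clustering phase: set $R\gets V$, $i\gets 1$; while $R\neq\emptyset$ and $i\le k$: if $s_i\in R$, output the cluster $C=\{s_i\}\cup(\Gamma^+(s_i)\cap R)$ and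 set $R\gets R\setminus C$; then set $i\gets i+1$. Finally output a separate singleton cluster for each remaining $v\in R$.
   Formalization: With replacement, the cost bound needs Q ≤ n(n−1)/2 (it fails for large Q); without replacement it holds for all Q. O(Q) time is for Q ≥ 1, with leftover singletons output implicitly, or explicitly if n ≤ Q+1. Q is rational. -}

module Defs where

open import Data.Bool using (Bool; true; false; if_then_else_; _∧_)
open import Data.Fin using (Fin; toℕ; _<?_)
open import Data.Integer as ℤ using (+_)
import Data.Integer.Properties as ℤ
open import Data.List using (List; []; _∷_; map; concatMap; filter; length; allFin; cartesianProduct)
open import Data.Nat as ℕ using (ℕ; zero; suc; _≡ᵇ_)
open import Data.Nat.ListAction using (sum)
import Data.Nat.Properties as ℕ
open import Data.Product using (_×_; _,_; proj₁; proj₂; ∃)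
open import Data.Rational as ℚ using (ℚ; 0ℚ; Positive)
import Data.Rational.Properties as ℚ
import Data.Rational.Unnormalised as ℚᵘ
import Data.Rational.Unnormalised.Properties as ℚᵘ
open import Data.Nat.Solver using (module +-*-Solver)
open import Data.Sign using (Sign)
open import Data.Sum using (inj₁; inj₂)
open import Data.Unit using (⊤)
open import Data.Vec.Functional using (Vector; replicate; updateAt)
open import Function using (const; _∘_)
open import Relation.Binary.PropositionalEquality using (_≡_; refl; sym; trans; cong; subst)
open import Relation.Nullary using (Dec; yes; no; contradiction)
open import Relation.Nullary.Decidable using (does; ¬?)

ι : ℕ → ℚ
ι m = + m ℚ./ 1

------------------------------------------------------------------------
-- Correlation clustering

-- The diagonal of `label` carries no meaning and is never consulted.
record LabelledGraph (n : ℕ) : Set where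
  field
    label     : Fin n → Fin n → Sign
    label-sym : ∀ x y → label x y ≡ label y x

Clustering : ℕ → Set
Clustering n = Fin n → ℕ

Pair : ℕ → Set
Pair n = Fin n × Fin n

-- Each unordered pair {x , y} appears once, as (x , y) with x < y.
pairs : ∀ n → List (Pair n)
pairs n = filter (λ (x , y) → x <? y) (cartesianProduct (allFin n) (allFin n))

module _ {n : ℕ} (G : LabelledGraph n) where
  open LabelledGraph G

  s : Pair n → ℕ
  s (x , y) with label x y
  ... | Sign.+ = 1
  ... | Sign.- = 0

  cost : Clustering n → ℕ
  cost ℓ = sum (map (λ e → 1 ℕ.∸ s e) (filter (λ (x , y) → ℓ x ℕ.≟ ℓ y) (pairs n)))
     ℕ.+ sum (map s (filter (λ (x , y) → ¬? (ℓ x ℕ.≟ ℓ y)) (pairs n)))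

  IsOPT : ℕ → Set
  IsOPT opt = (∃ λ ℓ → cost ℓ ≡ opt) × (∀ ℓ → opt ℕ.≤ cost ℓ)

------------------------------------------------------------------------
-- Uniform samples

data Sampling : Set where
  withReplacement withoutReplacement : Sampling

-- The possible first draws, each with what is available to later draws.
draws : ∀ {A : Set} → Sampling → List A → List (A × List A)
draws withReplacement    xs       = map (λ x → x , xs) xs
draws withoutReplacement []       = []
draws withoutReplacement (x ∷ xs) =
  (x , xs) ∷ map (λ (y , ys) → y , x ∷ ys) (draws withoutReplacement xs)

-- All equally likely outcomes of k successive draws: for a duplicate-free xs
-- these are all words of length k over xs, respectively all such words
-- without repetition, each listed once.
samples : ∀ {A : Set} → Sampling → ℕ → List A → List (List A)
samples m zero    xs = [] ∷ []
samples m (suc k) xs =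
  concatMap (λ (x , rest) → map (x ∷_) (samples m k rest)) (draws m xs)

-- The value on [] is a dummy: sample spaces of size k ≤ n are nonempty.
mean : List ℕ → ℚ
mean []          = 0ℚ
mean xs@(_ ∷ _) = + sum xs ℚ./ length xs

------------------------------------------------------------------------
-- Unit-cost computations
--
-- Array reads and writes and loop iterations cost one step each; an iteration
-- otherwise performs a bounded number of arithmetic operations and branches.
-- As in a RAM whose memory is initially zero, a blank array is free.

record Timed (A : Set) : Set where
  constructor timed
  field
    value : A
    steps : ℕ

open Timed public

return : ∀ {A : Set} → A → Timed A
return a = timed a 0

tick : Timed ⊤
tick = timed _ 1

infixl 1 _>>=_ _>>_

_>>=_ : ∀ {A B : Set} → Timed A → (A → Timed B) → Timed B
m >>= f = timed (value (f (value m))) (steps m ℕ.+ steps (f (value m)))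

_>>_ : ∀ {A B : Set} → Timed A → Timed B → Timed B
m >> m′ = m >>= const m′

read : ∀ {A : Set} {n} → Vector A n → Fin n → Timed A
read a i = timed (a i) 1

write : ∀ {A : Set} {n} → Vector A n → Fin n → A → Timed (Vector A n)
write a i x = timed (updateAt a i (const x)) 1

Matrix : Set → ℕ → Set
Matrix A n = Vector (Vector A n) n

read₂ : ∀ {A : Set} {n} → Matrix A n → Fin n → Fin n → Timed A
read₂ a i j = timed (a i j) 1

write₂ : ∀ {A : Set} {n} → Matrix A n → Fin n → Fin n → A → Timed (Matrix A n)
write₂ a i j x = timed (updateAt a i (λ row → updateAt row j (const x))) 1

forEach : ∀ {A St : Set} → List A → (A → St → Timed St) → St → Timed St
forEach []       body st = return st
forEach (x ∷ xs) body st = do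
  tick
  st′ ← body x st
  forEach xs body st′

-- All queries are fixed by `queries`, which has no access to any answer;
-- `decide` sees the graph only through the answers to these queries.
record NonAdaptive (n : ℕ) (Out : Set) : Set where
  field
    queries : Timed (List (Pair n))
    decide  : List (Pair n × Sign) → Timed Out

  asked : List (Pair n)
  asked = value queries

  module _ (G : LabelledGraph n) where
    open LabelledGraph G

    private
      decided : Timed Out
      decided = decide (map (λ (x , y) → (x , y) , label x y) asked)

    output : Out
    output = value decided

    time : ℕ
    time = steps queries ℕ.+ length asked ℕ.+ steps decided

------------------------------------------------------------------------
-- The sample size k = max { t ≤ n : (2n − 1 − t) t ≤ 2Q }

Feasible : ℕ → ℚ → ℕ → Set
Feasible n Q t = ι ((2 ℕ.* n ℕ.∸ 1 ℕ.∸ t) ℕ.* t) ℚ.≤ ι 2 ℚ.* Q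

IsMaxFeasible : ℕ → ℚ → ℕ → Set
IsMaxFeasible n Q r =
  r ℕ.≤ n × Feasible n Q r × (∀ t → t ℕ.≤ n → Feasible n Q t → t ℕ.≤ r)

feasible? : ∀ n Q t → Dec (Feasible n Q t)
feasible? n Q t = ι ((2 ℕ.* n ℕ.∸ 1 ℕ.∸ t) ℕ.* t) ℚ.≤? ι 2 ℚ.* Q

-- The left-hand side is nondecreasing for t ≤ n, so the maximum is found by
-- incrementing t until the inequality fails (see k-max).
search : ∀ n (Q : ℚ) (fuel t : ℕ) → Timed ℕ
search n Q zero       t = return t
search n Q (suc fuel) t = do
  tick
  if does (feasible? n Q (suc t)) then search n Q fuel (suc t) else return t

findK : ℕ → ℚ → Timed ℕ
findK n Q = search n Q n 0

k : ℕ → ℚ → ℕ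
k n Q = value (findK n Q)

private
  ι-mono : ∀ {a b} → a ℕ.≤ b → ι a ℚ.≤ ι b
  ι-mono {a} {b} a≤b = ℚ.toℚᵘ-cancel-≤
    (ℚᵘ.≤-respˡ-≃ (ℚᵘ.≃-sym (ℚ.toℚᵘ-fromℚᵘ (ℚᵘ.mkℚᵘ (+ a) 0)))
    (ℚᵘ.≤-respʳ-≃ (ℚᵘ.≃-sym (ℚ.toℚᵘ-fromℚᵘ (ℚᵘ.mkℚᵘ (+ b) 0)))
      (ℚᵘ.*≤* (ℤ.*-monoʳ-≤-nonNeg (+ 1) (ℤ.+≤+ a≤b)))))

  pairCount-step : ∀ n t → t ℕ.< n →
    (2 ℕ.* n ℕ.∸ 1 ℕ.∸ t) ℕ.* t ℕ.≤ (2 ℕ.* n ℕ.∸ 1 ℕ.∸ suc t) ℕ.* suc t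
  pairCount-step n t t<n with ℕ.m≤n⇒∃[o]m+o≡n t<n
  ... | d , refl = begin
    (2 ℕ.* (suc t ℕ.+ d) ℕ.∸ 1 ℕ.∸ t) ℕ.* t  ≡⟨ cong (ℕ._* t) diffˡ ⟩
    suc (t ℕ.+ (d ℕ.+ d)) ℕ.* t                ≤⟨ ℕ.+-monoˡ-≤ _ (ℕ.m≤m+n t (d ℕ.+ d)) ⟩
    r ℕ.+ r ℕ.* t                               ≡⟨ ℕ.*-suc r t ⟨
    r ℕ.* suc t                                  ≡⟨ cong (ℕ._* suc t) diffʳ ⟨
    (2 ℕ.* (suc t ℕ.+ d) ℕ.∸ 1 ℕ.∸ suc t) ℕ.* suc t ∎
    where
    open ℕ.≤-Reasoning
    r = t ℕ.+ (d ℕ.+ d)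
    double : 2 ℕ.* (suc t ℕ.+ d) ℕ.∸ 1 ≡ suc t ℕ.+ r
    double = solve 2 (λ t d → t :+ d :+ (con 1 :+ (t :+ d) :+ con 0)
                           := con 1 :+ t :+ (t :+ (d :+ d))) refl t d
      where open +-*-Solver
    diffʳ : 2 ℕ.* (suc t ℕ.+ d) ℕ.∸ 1 ℕ.∸ suc t ≡ r
    diffʳ = trans (cong (ℕ._∸ suc t) double) (ℕ.m+n∸m≡n (suc t) r)
    diffˡ : 2 ℕ.* (suc t ℕ.+ d) ℕ.∸ 1 ℕ.∸ t ≡ suc r
    diffˡ = trans (cong (ℕ._∸ t) (trans double (sym (ℕ.+-suc t r)))) (ℕ.m+n∸m≡n t (suc r))

  Feasible-down : ∀ {n Q t u} → t ℕ.≤ u → u ℕ.≤ n → Feasible n Q u → Feasible n Q t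
  Feasible-down {n} {Q} {t} {u} t≤u u≤n fu = ℚ.≤-trans (ι-mono (mono u t≤u u≤n)) fu
    where
    h : ℕ → ℕ
    h v = (2 ℕ.* n ℕ.∸ 1 ℕ.∸ v) ℕ.* v
    mono : ∀ v → t ℕ.≤ v → v ℕ.≤ n → h t ℕ.≤ h v
    mono v t≤v v≤n with ℕ.m≤n⇒m<n∨m≡n t≤v
    ... | inj₂ refl = ℕ.≤-refl
    mono (suc v) _ v<n | inj₁ (ℕ.s≤s t≤v) =
      ℕ.≤-trans (mono v t≤v (ℕ.<⇒≤ v<n)) (pairCount-step n v v<n)

  search-max : ∀ n Q fuel t → t ℕ.+ fuel ≡ n → Feasible n Q t →
               IsMaxFeasible n Q (value (search n Q fuel t))
  search-max n Q zero t refl ft =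
    ℕ.m≤m+n t 0 , ft , λ u u≤ _ → ℕ.≤-trans u≤ (ℕ.≤-reflexive (ℕ.+-identityʳ t))
  search-max n Q (suc fuel) t eq ft = go (feasible? n Q (suc t))
    where
    go : (d : Dec (Feasible n Q (suc t))) → IsMaxFeasible n Q
           (value (if does d then search n Q fuel (suc t) else return t))
    go (yes fst) = search-max n Q fuel (suc t) (trans (sym (ℕ.+-suc t fuel)) eq) fst
    go (no ¬fst) = subst (t ℕ.≤_) eq (ℕ.m≤m+n t (suc fuel)) , ft , below
      where
      below : ∀ u → u ℕ.≤ n → Feasible n Q u → u ℕ.≤ t
      below u u≤n fu with u ℕ.≤? t
      ... | yes u≤t = u≤t
      ... | no u≰t = contradiction (Feasible-down {n} {Q} (ℕ.≰⇒> u≰t) u≤n fu) ¬fst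

k-max : ∀ n Q .{{_ : Positive Q}} → IsMaxFeasible n Q (k n Q)
k-max n Q = search-max n Q n 0 refl feasible₀
  where
  feasible₀ : Feasible n Q 0
  feasible₀ = subst (ℚ._≤ ι 2 ℚ.* Q) (sym (cong ι (ℕ.*-zeroʳ (2 ℕ.* n ℕ.∸ 1))))
    (ℚ.<⇒≤ (ℚ.positive⁻¹ (ι 2 ℚ.* Q) {{ℚ.pos*pos⇒pos (ι 2) Q}}))

------------------------------------------------------------------------
-- Non-adaptive QECC

module _ {n : ℕ} where

  -- Skipping repeated samples, each s queries all w not sampled so far, so
  -- every pair meeting S is queried exactly once.
  plan : List (Fin n) → Timed (List (Pair n))
  plan S = do
    _ , qs ← forEach S queryFrom (replicate n false , [])
    return qs
    where
    queryFrom : Fin n → Vector Bool n × List (Pair n) → Timed (Vector Bool n × List (Pair n))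
    queryFrom v (sampled , qs) = do
      seen ← read sampled v
      if seen then return (sampled , qs) else do
        sampled′ ← write sampled v true
        qs′ ← forEach (allFin n) (λ w qs → do
          b ← read sampled′ w
          return (if b then qs else (v , w) ∷ qs)) qs
        return (sampled′ , qs′)

  -- plus v w = true iff {v , w} has been queried and is a "+" edge.
  storeAnswers : List (Pair n × Sign) → Timed (Matrix Bool n)
  storeAnswers answers = forEach answers store (replicate n (replicate n false))
    where
    store : Pair n × Sign → Matrix Bool n → Timed (Matrix Bool n)
    store (_       , Sign.-) plus = return plus
    store ((v , w) , Sign.+) plus = do
      plus′ ← write₂ plus v w true
      write₂ plus′ w v true

  -- R is the set of v with ℓ v = 0. The cluster of pivot v gets the label
  -- suc (toℕ v). Once R = ∅ every further iteration leaves ℓ unchanged, so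
  -- the loop is not cut short.
  pivot : List (Fin n) → Matrix Bool n → Timed (Clustering n)
  pivot S plus = forEach S cluster (replicate n 0)
    where
    cluster : Fin n → Clustering n → Timed (Clustering n)
    cluster v ℓ = do
      c ← read ℓ v
      if c ≡ᵇ 0 then (do
          ℓ′ ← write ℓ v (suc (toℕ v))
          forEach (allFin n) (λ w ℓ → do
            p ← read₂ plus v w
            d ← read ℓ w
            if p ∧ (d ≡ᵇ 0) then write ℓ w (suc (toℕ v)) else return ℓ) ℓ′)
        else return ℓ

  singletons : Clustering n → Timed (Clustering n)
  singletons = forEach (allFin n) (λ v ℓ → do
    c ← read ℓ v
    if c ≡ᵇ 0 then write ℓ v (suc (toℕ v)) else return ℓ)

  -- Without the final loop: vertices labelled 0 stand for the leftover
  -- singletons, which takes no time beyond the k iterations.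
  qecc-implicit : List (Fin n) → NonAdaptive n (Clustering n)
  qecc-implicit S = record
    { queries = plan S
    ; decide  = λ answers → storeAnswers answers >>= pivot S
    }

  qecc : List (Fin n) → NonAdaptive n (Clustering n)
  qecc S = record
    { queries = plan S
    ; decide  = λ answers → NonAdaptive.decide (qecc-implicit S) answers >>= singletons
    }

module _ {n : ℕ} (G : LabelledGraph n) (Q : ℚ) where

  sampleSpace : Sampling → List (List (Fin n))
  sampleSpace m = samples m (k n Q) (allFin n)

  queryCount : List (Fin n) → ℕ
  queryCount S = length (NonAdaptive.asked (qecc S))

  expectedCost : Sampling → ℚ
  expectedCost m =
    mean (map (λ S → cost G (NonAdaptive.output (qecc S) G)) (sampleSpace m))

  -- Finding k, drawing S at unit cost per draw, and executing A on G.
  runTime : (List (Fin n) → NonAdaptive n (Clustering n)) → List (Fin n) → ℕ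
  runTime A S = steps (findK n Q) ℕ.+ length S ℕ.+ NonAdaptive.time (A S) G

-- n³ / 2Q
slack : (n : ℕ) (Q : ℚ) → .{{Positive Q}} → ℚ
slack n Q = ι (n ℕ.^ 3) ℚ.÷ (ι 2 ℚ.* Q)
  where instance _ = ℚ.pos⇒nonZero (ι 2 ℚ.* Q) {{ℚ.pos*pos⇒pos (ι 2) Q}}

-- Let R be the set of unclustered vertices, fix an optimal clustering o, and call a triangle
-- bad if exactly one of its edges is negative. A pivot v errs exactly on the edges opposite v
-- in the bad triangles inside R; charge these errors to v. On each bad triangle, o errs on
-- some edge, and that edge leaves R when the opposite vertex is the pivot. Averaged over the
-- pivot, (errors charged so far) + 3 (errors of o inside R) therefore never increases, so
-- the expected charge is at most 3 OPT.
--
-- The remaining cost is the number e of positive edges left inside R after k draws. One draw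
-- removes at least 2e / n vertices from R on average, and e never increases, whence
-- 2 (k + 1) E[e] ≤ n². Hence E[e] ≤ n³ / 2Q as soon as Q ≤ n (k + 1), which for k < n is the
-- maximality of k. For k = n it follows from 2Q ≤ n (n - 1) with replacement, while without
-- replacement R ends up empty.
module Submission where

open import Defs
open import Data.Bool using (Bool; true; false; if_then_else_; _∧_; _∨_; not; _xor_; T; T?)
open import Data.Bool.Properties using (¬-not; ∧-comm; ∧-identityʳ; if-float; if-eta; if-cong; if-cong-then)
open import Data.Fin as Fin using (Fin; toℕ; _<?_; _≟_)
import Data.Fin.Properties as Fin
import Data.Integer as ℤ
import Data.Integer.Properties as ℤ
open import Data.List using (List; []; _∷_; _++_; map; concatMap; filter; length; allFin; cartesianProduct)
import Data.List.Properties as List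
open import Data.List.Membership.Propositional using (_∈_; find)
open import Data.List.Membership.Propositional.Properties using (∈-map⁺; ∈-map⁻; ∈-concatMap⁻; ∈-allFin)
open import Data.List.Relation.Unary.Any using (here; there)
open import Data.Maybe using (Maybe; just; nothing)
open import Data.Nat as ℕ using (ℕ; zero; suc; pred; _≡ᵇ_)
open import Data.Nat.ListAction using (sum)
open import Data.Nat.ListAction.Properties using (sum-++)
import Data.Nat.Properties as ℕ
open import Data.Nat.Solver using (module +-*-Solver)
open import Data.Product using (_×_; ∃; _,_; proj₁; proj₂)
open import Data.Product.Properties using (,-injective)
open import Data.Rational using (ℚ; Positive; _+_; _*_; _≤_; 0ℚ; 1ℚ)
import Data.Rational as ℚ
import Data.Rational.Properties as ℚ
import Data.Rational.Unnormalised as ℚᵘ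
import Data.Rational.Unnormalised.Properties as ℚᵘ
open import Data.Sign using (Sign)
open import Data.Sum using (_⊎_; inj₁; inj₂; [_,_]′)
open import Data.Vec.Functional using (Vector; updateAt)
open import Data.Vec.Functional.Properties using (updateAt-updates; updateAt-minimal)
open import Function using (_∘_; const; id; mk⇔)
open import Relation.Binary using (tri<; tri≈; tri>)
open import Relation.Binary.PropositionalEquality
open import Relation.Nullary using (Dec; yes; no; contradiction)
open import Relation.Nullary.Decidable
  using (does; ¬?; map′; _×-dec_; _→-dec_; True; toWitness; dec-true; dec-false; does-⇔)
open import Relation.Unary using (Pred; Decidable)

-- Probabilities are never divided out: an expectation is a natural-number sum over the list of all
-- samples, compared with the number of samples times a bound, and rationals enter only at the end.
-- Edges are summed over ordered pairs, so cost, charge and leftover edges all appear doubled. The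
-- triangle inequalities depend on at most a few Booleans and edge labels, which is why they are
-- stated for arbitrary such values and decided by enumeration. Both sampling modes share one
-- argument. What makes this possible is that a drawn vertex is clustered afterwards, so it makes no
-- difference to the gains whether it can be drawn again. The cap on `Q` with replacement reflects a
-- real obstruction. Beyond n(n-1)/2 the sample size stays at n while the slack tends to 0. Two
-- disjoint positive edges on four vertices have OPT = 0, yet with positive probability one of them
-- is never sampled, and then the algorithm pays for it.

private variable
  A B St : Set
  body : A → St → Timed St

-- Finite sums over lists

∑ : List A → (A → ℕ) → ℕ
∑ xs f = sum (map f xs)

∑-cong : ∀ (xs : List A) {f g} → (∀ x → f x ≡ g x) → ∑ xs f ≡ ∑ xs g
∑-cong xs f≗g = cong sum (List.map-cong f≗g xs)

∑-cong-∈ : ∀ (xs : List A) {f g} → (∀ {x} → x ∈ xs → f x ≡ g x) → ∑ xs f ≡ ∑ xs g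
∑-cong-∈ []       f≗g = refl
∑-cong-∈ (x ∷ xs) f≗g = cong₂ ℕ._+_ (f≗g (here refl)) (∑-cong-∈ xs (f≗g ∘ there))

∑-mono-∈ : ∀ (xs : List A) {f g} → (∀ {x} → x ∈ xs → f x ℕ.≤ g x) → ∑ xs f ℕ.≤ ∑ xs g
∑-mono-∈ []       f≤g = ℕ.z≤n
∑-mono-∈ (x ∷ xs) f≤g = ℕ.+-mono-≤ (f≤g (here refl)) (∑-mono-∈ xs (f≤g ∘ there))

∑-mono : ∀ (xs : List A) {f g} → (∀ x → f x ℕ.≤ g x) → ∑ xs f ℕ.≤ ∑ xs g
∑-mono xs f≤g = ∑-mono-∈ xs (λ {x} _ → f≤g x)

∑-+ : ∀ (xs : List A) f g → ∑ xs (λ x → f x ℕ.+ g x) ≡ ∑ xs f ℕ.+ ∑ xs g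
∑-+ []       f g = refl
∑-+ (x ∷ xs) f g rewrite ∑-+ xs f g =
  solve 4 (λ a b c d → a :+ b :+ (c :+ d) := a :+ c :+ (b :+ d)) refl (f x) (g x) (∑ xs f) (∑ xs g)
  where open +-*-Solver

∑-* : ∀ (xs : List A) c f → ∑ xs (λ x → c ℕ.* f x) ≡ c ℕ.* ∑ xs f
∑-* []       c f = sym (ℕ.*-zeroʳ c)
∑-* (x ∷ xs) c f rewrite ∑-* xs c f = sym (ℕ.*-distribˡ-+ c (f x) _)

∑-const : ∀ (xs : List A) c → ∑ xs (λ _ → c) ≡ length xs ℕ.* c
∑-const []       c = refl
∑-const (x ∷ xs) c = cong (c ℕ.+_) (∑-const xs c)

∑-zero : ∀ (xs : List A) {f} → (∀ x → f x ≡ 0) → ∑ xs f ≡ 0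
∑-zero xs f≗0 = trans (∑-cong xs f≗0) (trans (∑-const xs 0) (ℕ.*-zeroʳ (length xs)))

∑-swap : ∀ (xs : List A) (ys : List B) (f : A → B → ℕ) →
         ∑ xs (λ x → ∑ ys (f x)) ≡ ∑ ys (λ y → ∑ xs (λ x → f x y))
∑-swap []       ys f = sym (∑-zero ys (λ _ → refl))
∑-swap (x ∷ xs) ys f = trans (cong (∑ ys (f x) ℕ.+_) (∑-swap xs ys f))
                             (sym (∑-+ ys (f x) (λ y → ∑ xs (λ x → f x y))))

∑-map : ∀ (xs : List A) (h : A → B) f → ∑ (map h xs) f ≡ ∑ xs (f ∘ h)
∑-map xs h f = cong sum (sym (List.map-∘ xs))

∑-++ : ∀ (xs ys : List A) f → ∑ (xs ++ ys) f ≡ ∑ xs f ℕ.+ ∑ ys f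
∑-++ xs ys f = trans (cong sum (List.map-++ f xs ys)) (sum-++ (map f xs) (map f ys))

∑-concatMap : ∀ (xs : List A) (h : A → List B) f → ∑ (concatMap h xs) f ≡ ∑ xs (λ x → ∑ (h x) f)
∑-concatMap []       h f = refl
∑-concatMap (x ∷ xs) h f =
  trans (∑-++ (h x) (concatMap h xs) f) (cong (∑ (h x) f ℕ.+_) (∑-concatMap xs h f))

∑-cartesianProduct : ∀ (xs : List A) (ys : List B) f →
  ∑ (cartesianProduct xs ys) f ≡ ∑ xs (λ x → ∑ ys (λ y → f (x , y)))
∑-cartesianProduct []       ys f = refl
∑-cartesianProduct (x ∷ xs) ys f = trans (∑-++ (map (x ,_) ys) _ f)
  (cong₂ ℕ._+_ (∑-map ys (x ,_) f) (∑-cartesianProduct xs ys f))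

∑-filter : ∀ {ℓ} {P : Pred A ℓ} (P? : Decidable P) xs f →
           ∑ (filter P? xs) f ≡ ∑ xs (λ x → if does (P? x) then f x else 0)
∑-filter P? []       f = refl
∑-filter P? (x ∷ xs) f with does (P? x)
... | true  = cong (f x ℕ.+_) (∑-filter P? xs f)
... | false = ∑-filter P? xs f

length-∑ : ∀ (xs : List A) → length xs ≡ ∑ xs (λ _ → 1)
length-∑ xs = sym (trans (∑-const xs 1) (ℕ.*-identityʳ _))

-- Sampling

draws-first : ∀ m (xs : List A) → map proj₁ (draws m xs) ≡ xs
draws-first withReplacement    xs       = trans (sym (List.map-∘ xs)) (List.map-id xs)
draws-first withoutReplacement []       = refl
draws-first withoutReplacement (x ∷ xs) = cong (x ∷_)
  (trans (sym (List.map-∘ (draws withoutReplacement xs))) (draws-first withoutReplacement xs))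

∑-draws : ∀ m (xs : List A) f → ∑ (draws m xs) (f ∘ proj₁) ≡ ∑ xs f
∑-draws m xs f =
  trans (sym (∑-map (draws m xs) proj₁ f)) (cong (λ ys → ∑ ys f) (draws-first m xs))

∑-rest : ∀ (xs : List A) {y rest} → (y , rest) ∈ draws withoutReplacement xs →
         ∀ f → f y ℕ.+ ∑ rest f ≡ ∑ xs f
∑-rest (x ∷ xs) (here refl) f = refl
∑-rest (x ∷ xs) (there p)   f with ∈-map⁻ _ p
... | (y , ys) , q , refl = trans
  (solve 3 (λ a b c → a :+ (b :+ c) := b :+ (a :+ c)) refl (f y) (f x) (∑ ys f))
  (cong (f x ℕ.+_) (∑-rest xs q f))
  where open +-*-Solver

sizeAfterDraw : Sampling → ℕ → ℕ
sizeAfterDraw withReplacement    N = N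
sizeAfterDraw withoutReplacement N = pred N

length-rest : ∀ m (xs : List A) {y rest} → (y , rest) ∈ draws m xs →
              length rest ≡ sizeAfterDraw m (length xs)
length-rest withReplacement xs p with ∈-map⁻ _ p
... | _ , _ , refl = refl
length-rest withoutReplacement xs {y} {rest} p = cong pred (begin
  suc (length rest)          ≡⟨ cong suc (length-∑ rest) ⟩
  1 ℕ.+ ∑ rest (λ _ → 1)     ≡⟨ ∑-rest xs p (λ _ → 1) ⟩
  ∑ xs (λ _ → 1)             ≡⟨ length-∑ xs ⟨
  length xs                  ∎)
  where open ≡-Reasoning

-- The number of continuations after a draw depends only on the length of what remains, not on the
-- element drawn. Hence all first draws have equal weight, and a sum over samples is an iterated
-- uniform average.
sampleCount : Sampling → ℕ → ℕ → ℕ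
sampleCount m zero    N = 1
sampleCount m (suc j) N = N ℕ.* sampleCount m j (sizeAfterDraw m N)

∑-samples : ∀ m j (xs : List A) f →
  ∑ (samples m (suc j) xs) f
    ≡ ∑ (draws m xs) (λ (x , rest) → ∑ (samples m j rest) (f ∘ (x ∷_)))
∑-samples m j xs f = trans (∑-concatMap (draws m xs) _ f)
  (∑-cong (draws m xs) (λ (x , rest) → ∑-map (samples m j rest) (x ∷_) f))

length-samples : ∀ m j (xs : List A) → length (samples m j xs) ≡ sampleCount m j (length xs)
length-samples m zero    xs = refl
length-samples m (suc j) xs = begin
  length (samples m (suc j) xs)                            ≡⟨ length-∑ (samples m (suc j) xs) ⟩
  ∑ (samples m (suc j) xs) (λ _ → 1)                       ≡⟨ ∑-samples m j xs _ ⟩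
  ∑ (draws m xs) (λ (x , rest) → ∑ (samples m j rest) (λ _ → 1))
    ≡⟨ ∑-cong-∈ (draws m xs) (λ {(x , rest)} p →
         trans (sym (length-∑ (samples m j rest))) (trans (length-samples m j rest)
           (cong (sampleCount m j) (length-rest m xs p)))) ⟩
  ∑ (draws m xs) (λ _ → w)                                 ≡⟨ ∑-draws m xs _ ⟩
  ∑ xs (λ _ → w)                                           ≡⟨ ∑-const xs w ⟩
  length xs ℕ.* w                                          ∎
  where
  open ≡-Reasoning
  w = sampleCount m j (sizeAfterDraw m (length xs))

∈-samples⁻ : ∀ m j (xs : List A) {S} → S ∈ samples m (suc j) xs →
  ∃ λ x → ∃ λ rest → ∃ λ S′ → (x , rest) ∈ draws m xs × S′ ∈ samples m j rest × S ≡ x ∷ S′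
∈-samples⁻ m j xs p with find (∈-concatMap⁻ (λ (x , rest) → map (x ∷_) (samples m j rest)) {xs = draws m xs} p)
... | (x , rest) , q , p′ with ∈-map⁻ _ p′
... | S′ , S′∈ , refl = x , rest , S′ , q , S′∈ , refl

length-sample : ∀ m j (xs : List A) {S} → S ∈ samples m j xs → length S ≡ j
length-sample m zero    xs (here refl) = refl
length-sample m (suc j) xs p with ∈-samples⁻ m j xs p
... | x , rest , S′ , _ , S′∈ , refl = cong suc (length-sample m j rest S′∈)

-- Deterministic processes driven by random draws

module Process {A St : Set} (step : A → St → St) where

  run : List A → St → St
  run []      st = st
  run (x ∷ S) st = run S (step x st)

  -- The terminal value `end` serves two uses: with `end` zero this is the total charge, and with
  -- `end` equal to the gain it sums a quantity over all k + 1 states visited by k draws.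
  along : (A → St → ℕ) → (St → ℕ) → List A → St → ℕ
  along gain end []      st = end st
  along gain end (x ∷ S) st = gain x st ℕ.+ along gain end S (step x st)

  -- Φ bounds the expected total gain because gain + Φ is a supermartingale;
  -- expectations are scaled by the number of samples.
  module Drift
    (m : Sampling) (Inv : List A → St → Set)
    (inv-step : ∀ {xs st x rest} → Inv xs st → (x , rest) ∈ draws m xs → Inv rest (step x st))
    (gain : A → St → ℕ) (end Φ : St → ℕ)
    (end≤Φ : ∀ st → end st ℕ.≤ Φ st)
    (drift : ∀ {xs st} → Inv xs st →
             ∑ xs (λ x → gain x st ℕ.+ Φ (step x st)) ℕ.≤ length xs ℕ.* Φ st)
    where

    ∑-along≤ : ∀ j {xs st} → Inv xs st →
      ∑ (samples m j xs) (λ S → along gain end S st) ℕ.≤ length (samples m j xs) ℕ.* Φ st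
    ∑-along≤ zero    {xs} {st} _   = ℕ.+-monoˡ-≤ 0 (end≤Φ st)
    ∑-along≤ (suc j) {xs} {st} inv = begin
      ∑ (samples m (suc j) xs) (λ S → along gain end S st)
        ≡⟨ ∑-samples m j xs _ ⟩
      ∑ (draws m xs) (λ (x , rest) → ∑ (samples m j rest) (λ S → gain x st ℕ.+ along gain end S (step x st)))
        ≤⟨ ∑-mono-∈ (draws m xs) first-draw ⟩
      ∑ (draws m xs) (λ (x , _) → w ℕ.* (gain x st ℕ.+ Φ (step x st)))
        ≡⟨ ∑-draws m xs (λ x → w ℕ.* (gain x st ℕ.+ Φ (step x st))) ⟩
      ∑ xs (λ x → w ℕ.* (gain x st ℕ.+ Φ (step x st)))
        ≡⟨ ∑-* xs w _ ⟩
      w ℕ.* ∑ xs (λ x → gain x st ℕ.+ Φ (step x st))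
        ≤⟨ ℕ.*-monoʳ-≤ w (drift inv) ⟩
      w ℕ.* (length xs ℕ.* Φ st)
        ≡⟨ solve 3 (λ w l p → w :* (l :* p) := l :* w :* p) refl w (length xs) (Φ st) ⟩
      length xs ℕ.* w ℕ.* Φ st
        ≡⟨ cong (ℕ._* Φ st) (length-samples m (suc j) xs) ⟨
      length (samples m (suc j) xs) ℕ.* Φ st ∎
      where
      open ℕ.≤-Reasoning
      open +-*-Solver
      w = sampleCount m j (sizeAfterDraw m (length xs))
      first-draw : ∀ {xr} → xr ∈ draws m xs →
        ∑ (samples m j (proj₂ xr)) (λ S → gain (proj₁ xr) st ℕ.+ along gain end S (step (proj₁ xr) st))
          ℕ.≤ w ℕ.* (gain (proj₁ xr) st ℕ.+ Φ (step (proj₁ xr) st))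
      first-draw {x , rest} p = begin
        ∑ Ss (λ S → gain x st ℕ.+ along gain end S (step x st))
          ≡⟨ ∑-+ Ss _ _ ⟩
        ∑ Ss (λ _ → gain x st) ℕ.+ ∑ Ss (λ S → along gain end S (step x st))
          ≤⟨ ℕ.+-mono-≤ (ℕ.≤-reflexive (∑-const Ss _)) (∑-along≤ j (inv-step inv p)) ⟩
        length Ss ℕ.* gain x st ℕ.+ length Ss ℕ.* Φ (step x st)
          ≡⟨ ℕ.*-distribˡ-+ (length Ss) _ _ ⟨
        length Ss ℕ.* (gain x st ℕ.+ Φ (step x st))
          ≡⟨ cong (ℕ._* _) (trans (length-samples m j rest) (cong (sampleCount m j) (length-rest m xs p))) ⟩
        w ℕ.* (gain x st ℕ.+ Φ (step x st)) ∎
        where Ss = samples m j rest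

-- Triangles

Edge : Set
Edge = Maybe Sign

-- Quantifiers over Booleans and edges are finite, so `by-check` proves the local inequalities below
-- by evaluating their decision procedures.
∀Bool? : {P : Bool → Set} → Decidable P → Dec (∀ b → P b)
∀Bool? P? = map′ (λ { (f , t) false → f ; (f , t) true → t }) (λ p → p false , p true)
                 (P? false ×-dec P? true)

∀Edge? : {P : Edge → Set} → Decidable P → Dec (∀ e → P e)
∀Edge? P? = map′
  (λ { (o , p , m) nothing → o ; (o , p , m) (just Sign.+) → p ; (o , p , m) (just Sign.-) → m })
  (λ p → p nothing , p (just Sign.+) , p (just Sign.-))
  (P? nothing ×-dec P? (just Sign.+) ×-dec P? (just Sign.-))

by-check : {A : Set} (A? : Dec A) {_ : True A?} → A
by-check A? {t} = toWitness {a? = A?} t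

𝟙 : Bool → ℕ
𝟙 b = if b then 1 else 0

-- The Boolean says whether the endpoints share a cluster. In particular `mistake false` is the
-- indicator of a positive edge, and is used as such for degrees and leftover edges.
mistake : Bool → Edge → ℕ
mistake true  (just Sign.-) = 1
mistake false (just Sign.+) = 1
mistake _     _             = 0

badTriangle : Edge → Edge → Edge → ℕ
badTriangle (just Sign.+) (just Sign.+) (just Sign.-) = 1
badTriangle (just Sign.+) (just Sign.-) (just Sign.+) = 1
badTriangle (just Sign.-) (just Sign.+) (just Sign.+) = 1
badTriangle _             _             _             = 0

-- `nothing` is the degenerate edge from a vertex to itself.
joins : Edge → Bool
joins (just Sign.-) = false
joins _             = true

-- a and b say whether v and x are unclustered, e is the edge vx.
captured : Bool → Bool → Edge → Bool
captured a b e = a ∧ (b ∧ joins e)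

survives : Bool → Bool → Edge → Bool
survives a b e = b ∧ not (captured a b e)

captured⇒pivot : ∀ a b e → captured a b e ≡ true → a ≡ true
captured⇒pivot true b e eq = refl

-- a, b, c say whether v, x, y are unclustered; e, f, g are the edges vx, xy, vy.
weight : Bool → Bool → Bool → Edge → Edge → Edge → ℕ
weight a b c e f g = 𝟙 a ℕ.* (𝟙 b ℕ.* (𝟙 c ℕ.* badTriangle e f g))

weight-rotate : ∀ a b c e f g → weight a b c e f g ≡ weight b c a f g e
weight-rotate = by-check
  (∀Bool? λ a → ∀Bool? λ b → ∀Bool? λ c → ∀Edge? λ e → ∀Edge? λ f → ∀Edge? λ g →
    weight a b c e f g ℕ.≟ weight b c a f g e)

weight-reflect : ∀ a b c e f g → weight a b c e f g ≡ weight a c b g f e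
weight-reflect = by-check
  (∀Bool? λ a → ∀Bool? λ b → ∀Bool? λ c → ∀Edge? λ e → ∀Edge? λ f → ∀Edge? λ g →
    weight a b c e f g ℕ.≟ weight a c b g f e)

-- Two edges of a bad triangle are positive, so the pivot v captures x or y.
weight-removes : ∀ a b c s e f g →
  weight a b c e f g ℕ.* mistake s f
    ℕ.+ 𝟙 (survives a b e) ℕ.* (𝟙 (survives a c g) ℕ.* mistake s f)
    ℕ.≤ 𝟙 b ℕ.* (𝟙 c ℕ.* mistake s f)
weight-removes = by-check
  (∀Bool? λ a → ∀Bool? λ b → ∀Bool? λ c → ∀Bool? λ s →
   ∀Edge? λ e → ∀Edge? λ f → ∀Edge? λ g → _ ℕ.≤? _)

degree-removes : ∀ a b e →
  𝟙 (survives a b e) ℕ.+ 𝟙 a ℕ.* (𝟙 b ℕ.* mistake false e) ℕ.≤ 𝟙 b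
degree-removes = by-check
  (∀Bool? λ a → ∀Bool? λ b → ∀Edge? λ e → _ ℕ.≤? _)

survivors-mono : ∀ a b c e g m →
  𝟙 (survives a b e) ℕ.* (𝟙 (survives a c g) ℕ.* mistake false m) ℕ.≤ 𝟙 b ℕ.* (𝟙 c ℕ.* mistake false m)
survivors-mono = by-check
  (∀Bool? λ a → ∀Bool? λ b → ∀Bool? λ c →
   ∀Edge? λ e → ∀Edge? λ g → ∀Edge? λ m → _ ℕ.≤? _)

consistent : Bool → Bool → Bool → Bool
consistent p q r = (not (p ∧ q) ∨ r) ∧ (not (q ∧ r) ∨ p) ∧ (not (p ∧ r) ∨ q)

consistent-≡ : ∀ {A : Set} {x y z : A} (p : Dec (x ≡ y)) (q : Dec (y ≡ z)) (r : Dec (x ≡ z)) →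
               T (consistent (does p) (does q) (does r))
consistent-≡ (yes x≡y) (yes y≡z) (no x≢z)  = contradiction (trans x≡y y≡z) x≢z
consistent-≡ (yes x≡y) (no y≢z)  (yes x≡z) = contradiction (trans (sym x≡y) x≡z) y≢z
consistent-≡ (no x≢y)  (yes y≡z) (yes x≡z) = contradiction (trans x≡z (sym y≡z)) x≢y
consistent-≡ (yes _) (yes _) (yes _) = _
consistent-≡ (yes _) (no _)  (no _)  = _
consistent-≡ (no _)  (yes _) (no _)  = _
consistent-≡ (no _)  (no _)  (yes _) = _
consistent-≡ (no _)  (no _)  (no _)  = _

-- Being right on all three edges of a bad triangle would put exactly two of its three pairs
-- together, which transitivity of "same cluster" forbids; `consistent` records just that.
weight-hit : ∀ p q r a b c e f g → T (consistent p q r) →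
  weight a b c e f g ℕ.≤
    weight a b c e f g ℕ.* mistake p e ℕ.+ weight a b c e f g ℕ.* mistake q f
      ℕ.+ weight a b c e f g ℕ.* mistake r g
weight-hit = by-check
  (∀Bool? λ p → ∀Bool? λ q → ∀Bool? λ r → ∀Bool? λ a → ∀Bool? λ b → ∀Bool? λ c →
   ∀Edge? λ e → ∀Edge? λ f → ∀Edge? λ g → T? (consistent p q r) →-dec (_ ℕ.≤? _))

-- A pair with at most one live endpoint has its fate decided: a live endpoint can only enter a
-- later cluster, so a live and a clustered vertex already count as separated. Only pairs with both
-- endpoints live are still open.
settled : Bool → Bool → Bool → Edge → ℕ
settled b c s f = if b ∧ c then 0 else mistake s f

sameAfter : Bool → Bool → Bool → Bool
sameAfter i j s = if i then j else (not j ∧ s)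

-- A newly settled pair is wrong either because both endpoints were captured across a negative edge,
-- or because one was captured and the other, live, was left behind across a positive edge. Either
-- way it forms a bad triangle with the pivot, unless the pivot is an endpoint; then no error
-- occurs, and the first two hypotheses make this visible by identifying the two edges. The third
-- hypothesis says that a live and a clustered vertex carry different labels.
settled-step : ∀ a b c s e f g →
  (e ≡ nothing → f ≡ g) → (g ≡ nothing → f ≡ e) → ((b xor c) ≡ true → s ≡ false) →
  settled (survives a b e) (survives a c g) (sameAfter (captured a b e) (captured a c g) s) f
    ℕ.≤ settled b c s f ℕ.+ weight a b c e f g
settled-step = by-check
  (∀Bool? λ a → ∀Bool? λ b → ∀Bool? λ c → ∀Bool? λ s → ∀Edge? λ e → ∀Edge? λ f → ∀Edge? λ g →
   (e ≟ᵉ nothing →-dec f ≟ᵉ g) →-dec (g ≟ᵉ nothing →-dec f ≟ᵉ e) →-dec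
   ((b xor c) ≟ᵇ true →-dec s ≟ᵇ false) →-dec _ ℕ.≤? _)
  where
  open import Data.Bool using () renaming (_≟_ to _≟ᵇ_)
  open import Data.Maybe.Properties using (≡-dec)
  open import Data.Sign.Properties using () renaming (_≟_ to _≟ˢ_)
  _≟ᵉ_ : (e f : Edge) → Dec (e ≡ f)
  _≟ᵉ_ = ≡-dec _≟ˢ_
  infix 4 _≟ᵉ_

-- Freshness of `N` is assumed only when something is captured: the label of a pivot that is already
-- clustered may well be in use.
if-≟-if : ∀ i j (N p q : ℕ) → (i ≡ true → q ≢ N) → (j ≡ true → p ≢ N) →
  does ((if i then N else p) ℕ.≟ (if j then N else q)) ≡ sameAfter i j (does (p ℕ.≟ q))
if-≟-if true  true  N p q q≢N p≢N = dec-true (N ℕ.≟ N) refl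
if-≟-if true  false N p q q≢N p≢N = dec-false (N ℕ.≟ q) (q≢N refl ∘ sym)
if-≟-if false true  N p q q≢N p≢N = dec-false (p ℕ.≟ N) (p≢N refl)
if-≟-if false false N p q q≢N p≢N = refl

-- Loops and arrays

if-elim : (P : A → Set) (b : Bool) {x y : A} →
          (b ≡ true → P x) → (b ≡ false → P y) → P (if b then x else y)
if-elim P true  t f = t refl
if-elim P false t f = f refl

forEach-invariant : (P : St → Set) (xs : List A) →
  (∀ {x} → x ∈ xs → ∀ st → P st → P (value (body x st))) →
  ∀ {st} → P st → P (value (forEach xs body st))
forEach-invariant P []       step p = p
forEach-invariant P (x ∷ xs) step p =
  forEach-invariant P xs (step ∘ there) (step (here refl) _ p)

forEach-visits : (P : A → St → Set) (xs : List A) →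
  (∀ x st → P x (value (body x st))) → (∀ x y st → P y st → P y (value (body x st))) →
  ∀ {st y} → y ∈ xs → P y (value (forEach xs body st))
forEach-visits P (x ∷ xs) visit keep (here refl) =
  forEach-invariant (P x) xs (λ {y} _ st → keep y x st) (visit x _)
forEach-visits P (x ∷ xs) visit keep (there y∈)  = forEach-visits P xs visit keep y∈

forEach-measure : (μ : St → ℕ) (g : A → ℕ) (xs : List A) →
  (∀ x st → μ (value (body x st)) ℕ.≤ g x ℕ.+ μ st) →
  ∀ {st} → μ (value (forEach xs body st)) ℕ.≤ ∑ xs g ℕ.+ μ st
forEach-measure μ g []       step = ℕ.≤-refl
forEach-measure {body = body} μ g (x ∷ xs) step {st} = begin
  μ (value (forEach xs body (value (body x st))))
    ≤⟨ forEach-measure μ g xs step ⟩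
  ∑ xs g ℕ.+ μ (value (body x st))
    ≤⟨ ℕ.+-monoʳ-≤ (∑ xs g) (step x st) ⟩
  ∑ xs g ℕ.+ (g x ℕ.+ μ st)
    ≡⟨ solve 3 (λ a b c → a :+ (b :+ c) := b :+ a :+ c) refl (∑ xs g) (g x) (μ st) ⟩
  g x ℕ.+ ∑ xs g ℕ.+ μ st ∎
  where
  open ℕ.≤-Reasoning
  open +-*-Solver

forEach-steps : ∀ c (xs : List A) → (∀ x st → steps (body x st) ℕ.≤ c) →
  ∀ {st} → steps (forEach xs body st) ℕ.≤ length xs ℕ.* suc c
forEach-steps c []       bound = ℕ.z≤n
forEach-steps c (x ∷ xs) bound = ℕ.s≤s (ℕ.+-mono-≤ (bound x _) (forEach-steps c xs bound))

-- The disjunction is the induction invariant: the entry is still to be visited, or it is already a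
-- fixed point of its update. Idempotence turns the first case into the second at a visit, so
-- repeated visits do no harm.
forEach-pointwise : ∀ {n} {B : Set} {body : Fin n → Vector B n → Timed (Vector B n)}
  (g : Fin n → B → B) → (∀ u b → g u (g u b) ≡ g u b) →
  (∀ u a → value (body u a) u ≡ g u (a u)) → (∀ {u w} a → u ≢ w → value (body w a) u ≡ a u) →
  ∀ xs {a u} → u ∈ xs ⊎ g u (a u) ≡ a u → value (forEach xs body a) u ≡ g u (a u)
forEach-pointwise g idem at away []       (inj₂ fixed) = sym fixed
forEach-pointwise g idem at away (x ∷ xs) {a} {u} todo with u ≟ x
... | yes refl = trans
  (forEach-pointwise g idem at away xs
    (inj₂ (subst (λ b → g u b ≡ b) (sym (at u a)) (idem u (a u)))))
  (trans (cong (g u) (at u a)) (idem u (a u)))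
... | no u≢x = trans
  (forEach-pointwise g idem at away xs (todo′ todo))
  (cong (g u) (away a u≢x))
  where
  todo′ : u ∈ x ∷ xs ⊎ g u (a u) ≡ a u → u ∈ xs ⊎ g u _ ≡ _
  todo′ (inj₁ (here u≡x))  = contradiction u≡x u≢x
  todo′ (inj₁ (there u∈))  = inj₁ u∈
  todo′ (inj₂ fixed)       = inj₂ (subst (λ b → g u b ≡ b) (sym (away a u≢x)) fixed)

write₂-at : ∀ {n} (a : Matrix Bool n) i j → value (write₂ a i j true) i j ≡ true
write₂-at a i j = trans (cong (λ row → row j) (updateAt-updates i a)) (updateAt-updates j (a i))

write₂-true : ∀ {n} (a : Matrix Bool n) i j {x y} →
  value (write₂ a i j true) x y ≡ true → (x ≡ i × y ≡ j) ⊎ a x y ≡ true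
write₂-true a i j {x} {y} eq with x ≟ i
... | no x≢i = inj₂ (trans (cong (λ row → row y) (sym (updateAt-minimal x i a x≢i))) eq)
... | yes refl with y ≟ j
...   | yes y≡j = inj₁ (refl , y≡j)
...   | no y≢j  = inj₂ (trans (sym (trans (cong (λ row → row y) (updateAt-updates i a))
                                          (updateAt-minimal y j (a i) y≢j))) eq)

write₂-keeps : ∀ {n} (a : Matrix Bool n) i j {x y} →
  a x y ≡ true → value (write₂ a i j true) x y ≡ true
write₂-keeps a i j {x} {y} eq with x ≟ i
... | no x≢i = trans (cong (λ row → row y) (updateAt-minimal x i a x≢i)) eq
... | yes refl with y ≟ j
...   | yes refl = write₂-at a i j
...   | no y≢j   = trans (trans (cong (λ row → row y) (updateAt-updates i a))
                                (updateAt-minimal y j (a i) y≢j)) eq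

updateAt-true : ∀ {n} (a : Vector Bool n) i {x} →
  updateAt a i (const true) x ≡ true → x ≡ i ⊎ a x ≡ true
updateAt-true a i {x} eq with x ≟ i
... | yes x≡i = inj₁ x≡i
... | no x≢i  = inj₂ (trans (sym (updateAt-minimal x i a x≢i)) eq)

updateAt-keeps : ∀ {n} (a : Vector Bool n) i {x} →
  a x ≡ true → updateAt a i (const true) x ≡ true
updateAt-keeps a i {x} eq with x ≟ i
... | yes refl = updateAt-updates i a
... | no x≢i   = trans (updateAt-minimal x i a x≢i) eq

-- Size and completeness of the query plan

∑-indicator : ∀ {n} (v : Fin n) → ∑ (allFin n) (λ x → 𝟙 (does (x ≟ v))) ≡ 1
∑-indicator {suc n} v = trans
  (cong (λ xs → 𝟙 (does (Fin.zero ≟ v)) ℕ.+ ∑ xs (λ x → 𝟙 (does (x ≟ v)))) (sym (List.map-tabulate id Fin.suc)))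
  (trans (cong (𝟙 (does (Fin.zero ≟ v)) ℕ.+_) (∑-map (allFin n) Fin.suc _)) (by-head v))
  where
  by-head : (v : Fin (suc n)) → 𝟙 (does (Fin.zero ≟ v)) ℕ.+ ∑ (allFin n) (λ x → 𝟙 (does (Fin.suc x ≟ v))) ≡ 1
  by-head Fin.zero    = cong suc (∑-zero (allFin n) (λ _ → refl))
  by-head (Fin.suc v) = ∑-indicator v

module _ {n : ℕ} where

  countTrue : Vector Bool n → ℕ
  countTrue b = ∑ (allFin n) (𝟙 ∘ b)

  countTrue-updateAt : ∀ b v → b v ≡ false → countTrue (updateAt b v (const true)) ≡ suc (countTrue b)
  countTrue-updateAt b v bv = begin
    countTrue (updateAt b v (const true))          ≡⟨ ∑-cong (allFin n) pointwise ⟩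
    ∑ (allFin n) (λ x → 𝟙 (does (x ≟ v)) ℕ.+ 𝟙 (b x))       ≡⟨ ∑-+ (allFin n) _ _ ⟩
    ∑ (allFin n) (λ x → 𝟙 (does (x ≟ v))) ℕ.+ countTrue b   ≡⟨ cong (ℕ._+ countTrue b) (∑-indicator v) ⟩
    suc (countTrue b)                              ∎
    where
    open ≡-Reasoning
    pointwise : ∀ x → 𝟙 (updateAt b v (const true) x) ≡ 𝟙 (does (x ≟ v)) ℕ.+ 𝟙 (b x)
    pointwise x with x ≟ v
    ... | yes refl rewrite updateAt-updates v {const true} b | bv = refl
    ... | no x≢v   rewrite updateAt-minimal x v {const true} b x≢v = refl

  countTrue-not : ∀ b → ∑ (allFin n) (𝟙 ∘ not ∘ b) ℕ.+ countTrue b ≡ n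
  countTrue-not b = begin
    ∑ (allFin n) (𝟙 ∘ not ∘ b) ℕ.+ countTrue b     ≡⟨ ∑-+ (allFin n) _ _ ⟨
    ∑ (allFin n) (λ x → 𝟙 (not (b x)) ℕ.+ 𝟙 (b x)) ≡⟨ ∑-cong (allFin n) (λ x → one (b x)) ⟩
    ∑ (allFin n) (λ _ → 1)                         ≡⟨ length-∑ (allFin n) ⟨
    length (allFin n)                              ≡⟨ List.length-tabulate id ⟩
    n                                     ∎
    where
    open ≡-Reasoning
    one : ∀ c → 𝟙 (not c) ℕ.+ 𝟙 c ≡ 1
    one true  = refl
    one false = refl

  PlanState : Set
  PlanState = Vector Bool n × List (Pair n)

  Queried : List (Pair n) → Fin n → Fin n → Set
  Queried qs v w = (v , w) ∈ qs ⊎ (w , v) ∈ qs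

  -- d sampled vertices account for q ≤ (n - 1) + ... + (n - d) pairs, free of subtraction.
  Quota : ℕ → ℕ → Set
  Quota d q = 2 ℕ.* q ℕ.+ (d ℕ.* d ℕ.+ d) ℕ.≤ 2 ℕ.* n ℕ.* d

  record PlanInvariant (st : PlanState) : Set where
    constructor planned
    field
      quota : Quota (countTrue (proj₁ st)) (length (proj₂ st))
      known : ∀ v w → proj₁ st v ≡ true → v ≢ w → Queried (proj₂ st) v w

  -- Here `m` counts the vertices still unmarked once the new sample is marked; these are the pairs
  -- it adds.
  quota-step : ∀ q d m → m ℕ.+ suc d ≡ n → 2 ℕ.* q ℕ.+ (d ℕ.* d ℕ.+ d) ℕ.≤ 2 ℕ.* n ℕ.* d →
    2 ℕ.* (m ℕ.+ q) ℕ.+ (suc d ℕ.* suc d ℕ.+ suc d) ℕ.≤ 2 ℕ.* n ℕ.* suc d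
  quota-step q d m refl bound = begin
    2 ℕ.* (m ℕ.+ q) ℕ.+ (suc d ℕ.* suc d ℕ.+ suc d)
      ≡⟨ solve 3 (λ q d m → con 2 :* (m :+ q) :+ ((con 1 :+ d) :* (con 1 :+ d) :+ (con 1 :+ d))
           := con 2 :* q :+ (d :* d :+ d) :+ con 2 :* (m :+ (con 1 :+ d))) refl q d m ⟩
    2 ℕ.* q ℕ.+ (d ℕ.* d ℕ.+ d) ℕ.+ 2 ℕ.* n′
      ≤⟨ ℕ.+-monoˡ-≤ _ bound ⟩
    2 ℕ.* n′ ℕ.* d ℕ.+ 2 ℕ.* n′
      ≡⟨ solve 2 (λ t d → t :* d :+ t := t :* (con 1 :+ d)) refl (2 ℕ.* n′) d ⟩
    2 ℕ.* n′ ℕ.* suc d ∎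
    where
    open ℕ.≤-Reasoning
    open +-*-Solver
    n′ = m ℕ.+ suc d

  record Sampled (v : Fin n) (st : PlanState) : Set where
    constructor isSampled
    field flag : proj₁ st v ≡ true

  planned-fresh : ∀ {v sampled qs qs′} → PlanInvariant (sampled , qs) → sampled v ≡ false →
    length qs′ ℕ.≤ ∑ (allFin n) (𝟙 ∘ not ∘ updateAt sampled v (const true)) ℕ.+ length qs →
    (∀ p → p ∈ qs → p ∈ qs′) →
    (∀ w → updateAt sampled v (const true) w ≡ false → (v , w) ∈ qs′) →
    PlanInvariant (updateAt sampled v (const true) , qs′)
  planned-fresh {v} {sampled} {qs} {qs′} (planned quota known) fresh longer keeps adds =
    planned quota′ known′
    where
    sampled′ = updateAt sampled v (const true)
    quota′ : Quota (countTrue sampled′) (length qs′)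
    quota′ = subst (λ d → Quota d (length qs′)) (sym (countTrue-updateAt sampled v fresh))
      (ℕ.≤-trans (ℕ.+-monoˡ-≤ _ (ℕ.*-monoʳ-≤ 2 longer))
        (quota-step (length qs) (countTrue sampled) (∑ (allFin n) (𝟙 ∘ not ∘ sampled′))
          (trans (cong (∑ (allFin n) (𝟙 ∘ not ∘ sampled′) ℕ.+_) (sym (countTrue-updateAt sampled v fresh)))
                 (countTrue-not sampled′)) quota))
    known′ : ∀ u w → sampled′ u ≡ true → u ≢ w → Queried qs′ u w
    known′ u w u-sampled u≢w with updateAt-true sampled v u-sampled
    ... | inj₂ u-before = [ inj₁ ∘ keeps _ , inj₂ ∘ keeps _ ]′ (known u w u-before u≢w)
    ... | inj₁ refl with sampled′ w in eq
    ...   | false = inj₁ (adds w eq)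
    ...   | true with updateAt-true sampled u eq
    ...     | inj₁ w≡u      = contradiction (sym w≡u) u≢w
    -- The new sample skips `w` because `w` was marked earlier; the invariant for `w` already
    -- supplies the pair, with the orientations exchanged.
    ...     | inj₂ w-before = [ inj₂ ∘ keeps _ , inj₁ ∘ keeps _ ]′ (known w u w-before (u≢w ∘ sym))

  -- `plan` discards its array of marks. The existential recovers it, since the marks link the query
  -- list to the number of distinct samples.
  plan-final : ∀ S → ∃ λ st → proj₂ st ≡ value (plan S) × PlanInvariant st
    × countTrue (proj₁ st) ℕ.≤ length S × (∀ v → v ∈ S → Sampled v st)
  plan-final S = _ , refl
    , forEach-invariant PlanInvariant S
        (λ {v} _ (sampled , qs) inv → if-elim (λ (t : Timed PlanState) → PlanInvariant (value t)) (sampled v)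
          (λ _ → inv)
          (λ fresh → let sampled′ = updateAt sampled v (const true) in planned-fresh inv fresh
            (forEach-measure length (𝟙 ∘ not ∘ sampled′) (allFin n) (λ w qs →
              if-elim (λ t → length t ℕ.≤ 𝟙 (not (sampled′ w)) ℕ.+ length qs) (sampled′ w)
                (λ _ → ℕ.m≤n+m _ _)
                (λ unsampled → ℕ.≤-reflexive (cong (λ b → 𝟙 (not b) ℕ.+ length qs) (sym unsampled)))))
            (λ p → forEach-invariant (p ∈_) (allFin n) (λ {w} _ qs p∈ →
              if-elim (p ∈_) (sampled′ w) (λ _ → p∈) (λ _ → there p∈)))
            (λ w → forEach-visits (λ w qs → sampled′ w ≡ false → (v , w) ∈ qs) (allFin n)
              (λ w qs unsampled → if-elim ((v , w) ∈_) (sampled′ w)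
                (λ eq → contradiction (trans (sym unsampled) eq) (λ ())) (λ _ → here refl))
              (λ x y qs y∈ unsampled → if-elim ((v , y) ∈_) (sampled′ x)
                (λ _ → y∈ unsampled) (λ _ → there (y∈ unsampled)))
              (∈-allFin w))))
        (planned initially (λ _ _ ()))
    , ℕ.≤-trans
        (forEach-measure (countTrue ∘ proj₁) (λ _ → 1) S (λ v (sampled , qs) →
          if-elim (λ (t : Timed PlanState) → countTrue (proj₁ (value t)) ℕ.≤ suc (countTrue sampled)) (sampled v)
            (λ _ → ℕ.n≤1+n _)
            (λ fresh → ℕ.≤-reflexive (countTrue-updateAt sampled v fresh))))
        (ℕ.≤-reflexive (trans (cong₂ ℕ._+_ (sym (length-∑ S)) (∑-zero (allFin n) (λ _ → refl))) (ℕ.+-identityʳ _)))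
    , λ v → forEach-visits Sampled S
        (λ v (b , qs) → if-elim (λ t → Sampled v (value t)) (b v)
          isSampled (λ _ → isSampled (updateAt-updates v b)))
        (λ x y (b , qs) (isSampled marked) → if-elim (λ t → Sampled y (value t)) (b x)
          (λ _ → isSampled marked) (λ _ → isSampled (updateAt-keeps b x marked)))
    where
    initially : Quota (countTrue (const false)) 0
    initially rewrite ∑-zero (allFin n) {𝟙 ∘ const false} (λ _ → refl) = ℕ.z≤n

  -- Repeated samples can leave `d` below `k`. The allowance 2nd - d² - d grows by 2(n - d - 1) from
  -- `d` to d + 1, which is nonnegative as long as d < n.
  quota-mono : ∀ {q d k} → d ℕ.≤ k → k ℕ.≤ n → Quota d q → Quota k q
  quota-mono {q} {d} {k} d≤k k≤n quota with ℕ.m≤n⇒∃[o]m+o≡n d≤k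
  ... | zero  , refl = subst (λ k → Quota k q) (sym (ℕ.+-identityʳ d)) quota
  ... | suc c , refl with ℕ.m≤n⇒∃[o]m+o≡n k≤n
  ...   | e , eq = begin
    2 ℕ.* q ℕ.+ (k ℕ.* k ℕ.+ k)
      ≡⟨ solve 3 (λ q d c → con 2 :* q :+ ((d :+ (con 1 :+ c)) :* (d :+ (con 1 :+ c)) :+ (d :+ (con 1 :+ c)))
           := con 2 :* q :+ (d :* d :+ d) :+ (con 1 :+ c) :* (con 2 :* d :+ con 2 :+ c)) refl q d c ⟩
    2 ℕ.* q ℕ.+ (d ℕ.* d ℕ.+ d) ℕ.+ suc c ℕ.* (2 ℕ.* d ℕ.+ 2 ℕ.+ c)
      ≤⟨ ℕ.+-mono-≤ quota (ℕ.*-monoʳ-≤ (suc c) gap) ⟩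
    2 ℕ.* n ℕ.* d ℕ.+ suc c ℕ.* (2 ℕ.* n)
      ≡⟨ solve 3 (λ n d c → con 2 :* n :* d :+ (con 1 :+ c) :* (con 2 :* n)
           := con 2 :* n :* (d :+ (con 1 :+ c))) refl n d c ⟩
    2 ℕ.* n ℕ.* k ∎
    where
    open ℕ.≤-Reasoning
    open +-*-Solver
    gap : 2 ℕ.* d ℕ.+ 2 ℕ.+ c ℕ.≤ 2 ℕ.* n
    gap = begin
      2 ℕ.* d ℕ.+ 2 ℕ.+ c                       ≤⟨ ℕ.m≤m+n _ (c ℕ.+ 2 ℕ.* e) ⟩
      2 ℕ.* d ℕ.+ 2 ℕ.+ c ℕ.+ (c ℕ.+ 2 ℕ.* e)
        ≡⟨ solve 3 (λ d c e → con 2 :* d :+ con 2 :+ c :+ (c :+ con 2 :* e)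
             := con 2 :* (d :+ (con 1 :+ c) :+ e)) refl d c e ⟩
      2 ℕ.* (k ℕ.+ e)                           ≡⟨ cong (2 ℕ.*_) eq ⟩
      2 ℕ.* n                                   ∎

  2*asked≤ : ∀ {k} S → length S ℕ.≤ k → k ℕ.≤ n →
             2 ℕ.* length (value (plan S)) ℕ.≤ (2 ℕ.* n ℕ.∸ 1 ℕ.∸ k) ℕ.* k
  2*asked≤ {k} S size≤k k≤n with plan-final S
  ... | _ , refl , planned quota _ , count≤ , _ = begin
    2 ℕ.* q
      ≤⟨ ℕ.m+n≤o⇒m≤o∸n (2 ℕ.* q) (quota-mono {q} (ℕ.≤-trans count≤ size≤k) k≤n quota) ⟩
    2 ℕ.* n ℕ.* k ℕ.∸ (k ℕ.* k ℕ.+ k)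
      ≡⟨ cong (2 ℕ.* n ℕ.* k ℕ.∸_) (ℕ.+-comm (k ℕ.* k) k) ⟩
    2 ℕ.* n ℕ.* k ℕ.∸ suc k ℕ.* k
      ≡⟨ ℕ.*-distribʳ-∸ k (2 ℕ.* n) (suc k) ⟨
    (2 ℕ.* n ℕ.∸ suc k) ℕ.* k
      ≡⟨ cong (ℕ._* k) (ℕ.∸-+-assoc (2 ℕ.* n) 1 k) ⟨
    (2 ℕ.* n ℕ.∸ 1 ℕ.∸ k) ℕ.* k ∎
    where
    open ℕ.≤-Reasoning
    q = length (value (plan S))

  asked-complete : ∀ S {v w} → v ∈ S → v ≢ w → Queried (value (plan S)) v w
  asked-complete S {v} {w} v∈S v≢w with plan-final S
  ... | _ , refl , planned _ known , _ , all = known v w (Sampled.flag (all v v∈S)) v≢w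

-- Pivoting

∑∑-symmetric : ∀ {n} (f : Fin n → Fin n → ℕ) → (∀ x y → f x y ≡ f y x) → (∀ x → f x x ≡ 0) →
  ∑ (allFin n) (λ x → ∑ (allFin n) (f x)) ≡ 2 ℕ.* ∑ (pairs n) (λ (x , y) → f x y)
∑∑-symmetric {n} f f-sym f-diag = begin
  ∑ V (λ x → ∑ V (f x))
    ≡⟨ ∑-cong V (λ x → trans (∑-cong V (split x)) (∑-+ V (u x) (λ y → u y x))) ⟩
  ∑ V (λ x → ∑ V (u x) ℕ.+ ∑ V (λ y → u y x))
    ≡⟨ ∑-+ V _ _ ⟩
  ∑ V (λ x → ∑ V (u x)) ℕ.+ ∑ V (λ x → ∑ V (λ y → u y x))
    ≡⟨ cong (∑ V (λ x → ∑ V (u x)) ℕ.+_) (∑-swap V V (λ x y → u y x)) ⟩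
  ∑ V (λ x → ∑ V (u x)) ℕ.+ ∑ V (λ x → ∑ V (u x))
    ≡⟨ cong (∑ V (λ x → ∑ V (u x)) ℕ.+_) (ℕ.+-identityʳ _) ⟨
  2 ℕ.* ∑ V (λ x → ∑ V (u x))
    ≡⟨ cong (2 ℕ.*_) (trans (∑-filter _ (cartesianProduct V V) _) (∑-cartesianProduct V V _)) ⟨
  2 ℕ.* ∑ (pairs n) (λ (x , y) → f x y) ∎
  where
  open ≡-Reasoning
  V = allFin n
  u : Fin n → Fin n → ℕ
  u x y = if does (x <? y) then f x y else 0
  split : ∀ x y → f x y ≡ u x y ℕ.+ u y x
  split x y with Fin.<-cmp x y
  ... | tri< x<y _ y≮x rewrite dec-true (x <? y) x<y | dec-false (y <? x) y≮x = sym (ℕ.+-identityʳ _)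
  ... | tri≈ x≮y refl y≮x rewrite dec-false (x <? y) x≮y = f-diag x
  ... | tri> x≮y _ y<x rewrite dec-false (x <? y) x≮y | dec-true (y <? x) y<x = f-sym x y

module Analysis {n : ℕ} (G : LabelledGraph n) where
  open LabelledGraph G

  V : List (Fin n)
  V = allFin n

  length-V : length V ≡ n
  length-V = List.length-tabulate id

  -- Ordered pairs: every unordered pair is counted twice.
  ∑∑ : (Fin n → Fin n → ℕ) → ℕ
  ∑∑ f = ∑ V (λ x → ∑ V (f x))

  ∑∑-mono : ∀ {f g} → (∀ x y → f x y ℕ.≤ g x y) → ∑∑ f ℕ.≤ ∑∑ g
  ∑∑-mono f≤g = ∑-mono V (λ x → ∑-mono V (f≤g x))

  ∑∑-+ : ∀ f g → ∑∑ (λ x y → f x y ℕ.+ g x y) ≡ ∑∑ f ℕ.+ ∑∑ g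
  ∑∑-+ f g = trans (∑-cong V (λ x → ∑-+ V (f x) (g x))) (∑-+ V _ _)

  edge : Fin n → Fin n → Edge
  edge x y = if does (x ≟ y) then nothing else just (label x y)

  edge-refl : ∀ x → edge x x ≡ nothing
  edge-refl x rewrite dec-true (x ≟ x) refl = refl

  edge-≢ : ∀ {x y} → x ≢ y → edge x y ≡ just (label x y)
  edge-≢ {x} {y} x≢y rewrite dec-false (x ≟ y) x≢y = refl

  edge-sym : ∀ x y → edge x y ≡ edge y x
  edge-sym x y with x ≟ y
  ... | yes refl = sym (edge-refl x)
  ... | no x≢y   = trans (cong just (label-sym x y)) (sym (edge-≢ (x≢y ∘ sym)))

  errors : Clustering n → Fin n → Fin n → ℕ
  errors ℓ x y = mistake (does (ℓ x ℕ.≟ ℓ y)) (edge x y)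

  errors-sym : ∀ ℓ x y → errors ℓ x y ≡ errors ℓ y x
  errors-sym ℓ x y = cong₂ mistake same-sym (edge-sym x y)
    where
    same-sym : does (ℓ x ℕ.≟ ℓ y) ≡ does (ℓ y ℕ.≟ ℓ x)
    same-sym = does-⇔ (mk⇔ sym sym) (ℓ x ℕ.≟ ℓ y) (ℓ y ℕ.≟ ℓ x)

  errors-diag : ∀ ℓ x → errors ℓ x x ≡ 0
  errors-diag ℓ x rewrite edge-refl x = mistake-nothing (does (ℓ x ℕ.≟ ℓ x))
    where
    mistake-nothing : ∀ b → mistake b nothing ≡ 0
    mistake-nothing true  = refl
    mistake-nothing false = refl

  ∑∑-errors : ∀ ℓ → ∑∑ (errors ℓ) ≡ 2 ℕ.* cost G ℓ
  ∑∑-errors ℓ = trans (∑∑-symmetric (errors ℓ) (errors-sym ℓ) (errors-diag ℓ)) (cong (2 ℕ.*_) (begin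
    ∑ (pairs n) (λ (x , y) → errors ℓ x y)
      ≡⟨ ∑-filter (λ (x , y) → x <? y) VV _ ⟩
    ∑ VV (λ (x , y) → if does (x <? y) then errors ℓ x y else 0)
      ≡⟨ ∑-cong VV (λ (x , y) → split x y) ⟩
    ∑ VV (λ (x , y) → (if does (x <? y) then inner x y else 0) ℕ.+ (if does (x <? y) then outer x y else 0))
      ≡⟨ ∑-+ VV _ _ ⟩
    ∑ VV (λ (x , y) → if does (x <? y) then inner x y else 0)
        ℕ.+ ∑ VV (λ (x , y) → if does (x <? y) then outer x y else 0)
      ≡⟨ cong₂ ℕ._+_ (∑-filter (λ (x , y) → x <? y) VV _) (∑-filter (λ (x , y) → x <? y) VV _) ⟨
    ∑ (pairs n) (λ (x , y) → inner x y) ℕ.+ ∑ (pairs n) (λ (x , y) → outer x y)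
      ≡⟨ cong₂ ℕ._+_ (∑-filter (λ (x , y) → ℓ x ℕ.≟ ℓ y) (pairs n) _)
                     (∑-filter (λ (x , y) → ¬? (ℓ x ℕ.≟ ℓ y)) (pairs n) _) ⟨
    cost G ℓ ∎))
    where
    open ≡-Reasoning
    VV = cartesianProduct V V
    inner outer : Fin n → Fin n → ℕ
    inner x y = if does (ℓ x ℕ.≟ ℓ y) then 1 ℕ.∸ s G (x , y) else 0
    outer x y = if does (¬? (ℓ x ℕ.≟ ℓ y)) then s G (x , y) else 0
    split : ∀ x y → (if does (x <? y) then errors ℓ x y else 0) ≡
            (if does (x <? y) then inner x y else 0) ℕ.+ (if does (x <? y) then outer x y else 0)
    split x y = by-order (x <? y)
      where
      by-label : ∀ b → mistake b (just (label x y)) ≡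
        (if b then 1 ℕ.∸ s G (x , y) else 0) ℕ.+ (if not b then s G (x , y) else 0)
      by-label b with b | label x y
      ... | true  | Sign.+ = refl
      ... | true  | Sign.- = refl
      ... | false | Sign.+ = refl
      ... | false | Sign.- = refl
      by-order : (d : Dec (x Fin.< y)) → (if does d then errors ℓ x y else 0) ≡
        (if does d then inner x y else 0) ℕ.+ (if does d then outer x y else 0)
      by-order (no _)    = refl
      by-order (yes x<y) rewrite edge-≢ {x} {y} (λ { refl → ℕ.<-irrefl refl x<y }) =
        by-label (does (ℓ x ℕ.≟ ℓ y))

  live : Clustering n → Fin n → Bool
  live ℓ x = ℓ x ≡ᵇ 0

  -- One iteration of the clustering loop as a simultaneous relabelling. Since `captured` requires a
  -- live pivot, a clustered pivot changes nothing.
  absorb : Fin n → Clustering n → Clustering n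
  absorb v ℓ x = if captured (live ℓ v) (live ℓ x) (edge v x) then suc (toℕ v) else ℓ x

  open Process absorb public

  live-absorb : ∀ v ℓ x → live (absorb v ℓ) x ≡ survives (live ℓ v) (live ℓ x) (edge v x)
  live-absorb v ℓ x with live ℓ v
  ... | false = sym (∧-identityʳ _)
  ... | true with live ℓ x in eq
  ...   | false = eq
  ...   | true with joins (edge v x)
  ...     | true  = refl
  ...     | false = eq

  -- Charging errors to bad triangles

  triangle : Clustering n → Fin n → Fin n → Fin n → ℕ
  triangle ℓ v x y = weight (live ℓ v) (live ℓ x) (live ℓ y) (edge v x) (edge x y) (edge v y)

  triangle-rotate : ∀ ℓ v x y → triangle ℓ v x y ≡ triangle ℓ x y v
  triangle-rotate ℓ v x y rewrite edge-sym y v | edge-sym x v =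
    weight-rotate (live ℓ v) (live ℓ x) (live ℓ y) _ _ _

  triangle-reflect : ∀ ℓ v x y → triangle ℓ v x y ≡ triangle ℓ v y x
  triangle-reflect ℓ v x y rewrite edge-sym y x =
    weight-reflect (live ℓ v) (live ℓ x) (live ℓ y) _ _ _

  charge : Fin n → Clustering n → ℕ
  charge v ℓ = ∑∑ (triangle ℓ v)

  liveErrors : Clustering n → Clustering n → ℕ
  liveErrors o ℓ = ∑∑ (λ x y → 𝟙 (live ℓ x) ℕ.* (𝟙 (live ℓ y) ℕ.* errors o x y))

  hits : Clustering n → Fin n → Clustering n → ℕ
  hits o v ℓ = ∑∑ (λ x y → triangle ℓ v x y ℕ.* errors o x y)

  hits-removed : ∀ o v ℓ → hits o v ℓ ℕ.+ liveErrors o (absorb v ℓ) ℕ.≤ liveErrors o ℓ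
  hits-removed o v ℓ = ℕ.≤-trans (ℕ.≤-reflexive (sym (∑∑-+ _ _))) (∑∑-mono pointwise)
    where
    pointwise : ∀ x y → triangle ℓ v x y ℕ.* errors o x y
        ℕ.+ 𝟙 (live (absorb v ℓ) x) ℕ.* (𝟙 (live (absorb v ℓ) y) ℕ.* errors o x y)
      ℕ.≤ 𝟙 (live ℓ x) ℕ.* (𝟙 (live ℓ y) ℕ.* errors o x y)
    pointwise x y rewrite live-absorb v ℓ x | live-absorb v ℓ y =
      weight-removes (live ℓ v) (live ℓ x) (live ℓ y) _ (edge v x) (edge x y) (edge v y)

  triangle-hit : ∀ o ℓ v x y → triangle ℓ v x y ℕ.≤
    triangle ℓ v x y ℕ.* errors o v x ℕ.+ triangle ℓ v x y ℕ.* errors o x y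
      ℕ.+ triangle ℓ v x y ℕ.* errors o v y
  triangle-hit o ℓ v x y =
    weight-hit _ _ _ (live ℓ v) (live ℓ x) (live ℓ y) (edge v x) (edge x y) (edge v y)
      (consistent-≡ (o v ℕ.≟ o x) (o x ℕ.≟ o y) (o v ℕ.≟ o y))

  -- Origin of the factor 3: `o` errs on one of the three edges, and over all ordered triples the
  -- three edge positions contribute equally, because rotating or reflecting a triangle carries any
  -- edge to the one opposite the pivot.
  ∑-charge≤ : ∀ o ℓ → ∑ V (λ v → charge v ℓ) ℕ.≤ 3 ℕ.* ∑ V (λ v → hits o v ℓ)
  ∑-charge≤ o ℓ = begin
    ∑ V (λ v → charge v ℓ)
      ≤⟨ ∑-mono V (λ v → ∑∑-mono (triangle-hit o ℓ v)) ⟩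
    ∑ V (λ v → ∑∑ (λ x y → a v x y ℕ.+ b v x y ℕ.+ c v x y))
      ≡⟨ ∑-cong V (λ v → trans (∑∑-+ (λ x y → a v x y ℕ.+ b v x y) (c v))
                              (cong (ℕ._+ ∑∑ (c v)) (∑∑-+ (a v) (b v)))) ⟩
    ∑ V (λ v → ∑∑ (a v) ℕ.+ ∑∑ (b v) ℕ.+ ∑∑ (c v))
      ≡⟨ trans (∑-+ V _ _) (cong (ℕ._+ ∑ V (λ v → ∑∑ (c v))) (∑-+ V _ _)) ⟩
    ∑ V (λ v → ∑∑ (a v)) ℕ.+ H ℕ.+ ∑ V (λ v → ∑∑ (c v))
      ≡⟨ cong₂ (λ i j → i ℕ.+ H ℕ.+ j) a≡H c≡H ⟩
    H ℕ.+ H ℕ.+ H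
      ≡⟨ solve 1 (λ h → h :+ h :+ h := con 3 :* h) refl H ⟩
    3 ℕ.* H ∎
    where
    open ℕ.≤-Reasoning
    open +-*-Solver
    a b c : Fin n → Fin n → Fin n → ℕ
    a v x y = triangle ℓ v x y ℕ.* errors o v x
    b v x y = triangle ℓ v x y ℕ.* errors o x y
    c v x y = triangle ℓ v x y ℕ.* errors o v y
    H = ∑ V (λ v → ∑∑ (b v))
    a≡H : ∑ V (λ v → ∑∑ (a v)) ≡ H
    a≡H = trans
      (∑-cong V (λ v → trans (∑-cong V (λ x → ∑-cong V (λ y →
        cong (ℕ._* errors o v x) (sym (triangle-rotate ℓ y v x)))))
        (∑-swap V V (λ x y → b y v x))))
      (∑-swap V V (λ v y → ∑ V (b y v)))
    c≡H : ∑ V (λ v → ∑∑ (c v)) ≡ H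
    c≡H = trans
      (∑-cong V (λ v → trans (∑-swap V V (c v)) (∑-cong V (λ y → ∑-cong V (λ x →
        cong (ℕ._* errors o v y) (triangle-reflect ℓ v x y))))))
      a≡H

  -- Off the live vertices the pivot does nothing, so the draws still pending
  -- matter only through the live vertices, each of which occurs once.
  record Pending (xs : List (Fin n)) (ℓ : Clustering n) : Set where
    field
      size≤ : length xs ℕ.≤ n
      ∑-live : ∀ f → (∀ v → live ℓ v ≡ false → f v ≡ 0) → ∑ xs f ≡ ∑ V f
  open Pending public

  absorb-dead : ∀ v ℓ {x} → live ℓ x ≡ false → live (absorb v ℓ) x ≡ false
  absorb-dead v ℓ {x} dead = trans (live-absorb v ℓ x)
    (cong (λ b → survives (live ℓ v) b (edge v x)) dead)

  absorb-pivot-dead : ∀ v ℓ → live (absorb v ℓ) v ≡ false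
  absorb-pivot-dead v ℓ = trans (live-absorb v ℓ v)
    (trans (cong (survives (live ℓ v) (live ℓ v)) (edge-refl v)) (survives-self (live ℓ v)))
    where
    survives-self : ∀ a → survives a a nothing ≡ false
    survives-self false = refl
    survives-self true  = refl

  -- The drawn vertex is dead afterwards, whether or not it was live before, so deleting it from the
  -- pending draws changes no sum of a function supported on live vertices.
  pending-step : ∀ m {xs ℓ v rest} → Pending xs ℓ → (v , rest) ∈ draws m xs →
                 Pending rest (absorb v ℓ)
  pending-step m {xs} {ℓ} {v} {rest} P p = record
    { size≤  = ℕ.≤-trans (ℕ.≤-reflexive (length-rest m xs p)) (ℕ.≤-trans (shrinks m (length xs)) (size≤ P))
    ; ∑-live = λ f f-dead → trans (∑-same m p f (f-dead v (absorb-pivot-dead v ℓ)))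
                 (∑-live P f (λ u dead → f-dead u (absorb-dead v ℓ dead)))
    }
    where
    shrinks : ∀ m N → sizeAfterDraw m N ℕ.≤ N
    shrinks withReplacement    N = ℕ.≤-refl
    shrinks withoutReplacement N = ℕ.pred[n]≤n
    ∑-same : ∀ m → (v , rest) ∈ draws m xs → ∀ f → f v ≡ 0 → ∑ rest f ≡ ∑ xs f
    ∑-same withReplacement    p f fv≡0 with ∈-map⁻ _ p
    ... | _ , _ , refl = refl
    ∑-same withoutReplacement p f fv≡0 = trans (cong (ℕ._+ ∑ rest f) (sym fv≡0)) (∑-rest xs p f)

  -- The symmetry behind `∑-charge≤` needs the pivot to range over all of `V`. As charge and hits
  -- vanish at dead pivots, `∑-live` passes from the pending draws to `V` and back.
  charge-drift : ∀ o {xs ℓ} → Pending xs ℓ →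
    ∑ xs (λ v → charge v ℓ ℕ.+ 3 ℕ.* liveErrors o (absorb v ℓ)) ℕ.≤ length xs ℕ.* (3 ℕ.* liveErrors o ℓ)
  charge-drift o {xs} {ℓ} P = begin
    ∑ xs (λ v → charge v ℓ ℕ.+ 3 ℕ.* L v)
      ≡⟨ ∑-+ xs _ _ ⟩
    ∑ xs (λ v → charge v ℓ) ℕ.+ ∑ xs (λ v → 3 ℕ.* L v)
      ≡⟨ cong₂ ℕ._+_ (∑-live P _ charge-dead) (∑-* xs 3 L) ⟩
    ∑ V (λ v → charge v ℓ) ℕ.+ 3 ℕ.* ∑ xs L
      ≤⟨ ℕ.+-monoˡ-≤ _ (∑-charge≤ o ℓ) ⟩
    3 ℕ.* ∑ V (λ v → hits o v ℓ) ℕ.+ 3 ℕ.* ∑ xs L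
      ≡⟨ cong (λ t → 3 ℕ.* t ℕ.+ 3 ℕ.* ∑ xs L) (∑-live P _ hits-dead) ⟨
    3 ℕ.* ∑ xs (λ v → hits o v ℓ) ℕ.+ 3 ℕ.* ∑ xs L
      ≡⟨ trans (cong (3 ℕ.*_) (∑-+ xs (λ v → hits o v ℓ) L)) (ℕ.*-distribˡ-+ 3 (∑ xs (λ v → hits o v ℓ)) _) ⟨
    3 ℕ.* ∑ xs (λ v → hits o v ℓ ℕ.+ L v)
      ≤⟨ ℕ.*-monoʳ-≤ 3 (∑-mono xs (λ v → hits-removed o v ℓ)) ⟩
    3 ℕ.* ∑ xs (λ _ → liveErrors o ℓ)
      ≡⟨ trans (sym (∑-* xs 3 _)) (∑-const xs _) ⟩
    length xs ℕ.* (3 ℕ.* liveErrors o ℓ) ∎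
    where
    open ℕ.≤-Reasoning
    L = λ v → liveErrors o (absorb v ℓ)
    charge-dead : ∀ v → live ℓ v ≡ false → charge v ℓ ≡ 0
    charge-dead v dead rewrite dead = ∑-zero V (λ x → ∑-zero V (λ y → refl))
    hits-dead : ∀ v → live ℓ v ≡ false → hits o v ℓ ≡ 0
    hits-dead v dead rewrite dead = ∑-zero V (λ x → ∑-zero V (λ y → refl))

  -- Positive edges left among the live vertices

  livePlus : Clustering n → ℕ
  livePlus ℓ = ∑∑ (λ x y → 𝟙 (live ℓ x) ℕ.* (𝟙 (live ℓ y) ℕ.* mistake false (edge x y)))

  liveCount : Clustering n → ℕ
  liveCount ℓ = ∑ V (λ x → 𝟙 (live ℓ x))

  -- Lets the potential also pay for the state after the last draw, which is what makes k + 1 terms,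
  -- rather than k, available in the average.
  livePlus≤ : ∀ ℓ → livePlus ℓ ℕ.≤ n ℕ.* liveCount ℓ
  livePlus≤ ℓ = begin
    livePlus ℓ
      ≤⟨ ∑∑-mono (λ x y → ≤𝟙 (live ℓ x) (live ℓ y) (edge x y)) ⟩
    ∑∑ (λ x _ → 𝟙 (live ℓ x))
      ≡⟨ ∑-cong V (λ x → trans (∑-const V _) (cong (ℕ._* 𝟙 (live ℓ x)) length-V)) ⟩
    ∑ V (λ x → n ℕ.* 𝟙 (live ℓ x))
      ≡⟨ ∑-* V n _ ⟩
    n ℕ.* liveCount ℓ ∎
    where
    open ℕ.≤-Reasoning
    ≤𝟙 : ∀ a b e → 𝟙 a ℕ.* (𝟙 b ℕ.* mistake false e) ℕ.≤ 𝟙 a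
    ≤𝟙 = by-check (∀Bool? λ a → ∀Bool? λ b → ∀Edge? λ e → _ ℕ.≤? _)

  livePlus-absorb : ∀ v ℓ → livePlus (absorb v ℓ) ℕ.≤ livePlus ℓ
  livePlus-absorb v ℓ = ∑∑-mono pointwise
    where
    pointwise : ∀ x y →
      𝟙 (live (absorb v ℓ) x) ℕ.* (𝟙 (live (absorb v ℓ) y) ℕ.* mistake false (edge x y))
        ℕ.≤ 𝟙 (live ℓ x) ℕ.* (𝟙 (live ℓ y) ℕ.* mistake false (edge x y))
    pointwise x y rewrite live-absorb v ℓ x | live-absorb v ℓ y =
      survivors-mono (live ℓ v) (live ℓ x) (live ℓ y) (edge v x) (edge v y) (edge x y)

  livePlus-drift : ∀ {xs ℓ} → Pending xs ℓ →
    ∑ xs (λ v → livePlus ℓ ℕ.+ n ℕ.* liveCount (absorb v ℓ)) ℕ.≤ length xs ℕ.* (n ℕ.* liveCount ℓ)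
  livePlus-drift {xs} {ℓ} P = begin
    ∑ xs (λ v → livePlus ℓ ℕ.+ n ℕ.* C v)
      ≡⟨ trans (∑-+ xs _ _) (cong₂ ℕ._+_ (∑-const xs _) (∑-* xs n C)) ⟩
    length xs ℕ.* livePlus ℓ ℕ.+ n ℕ.* ∑ xs C
      -- With at most `n` pending draws, each live vertex is drawn with probability at least 1/n;
      -- this is why the potential pays `n` per live vertex.
      ≤⟨ ℕ.+-monoˡ-≤ _ (ℕ.*-monoˡ-≤ (livePlus ℓ) (size≤ P)) ⟩
    n ℕ.* livePlus ℓ ℕ.+ n ℕ.* ∑ xs C
      ≡⟨ ℕ.*-distribˡ-+ n _ _ ⟨
    n ℕ.* (livePlus ℓ ℕ.+ ∑ xs C)
      ≡⟨ cong (λ t → n ℕ.* (t ℕ.+ ∑ xs C)) (∑-live P _ degree-dead) ⟨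
    n ℕ.* (∑ xs degree ℕ.+ ∑ xs C)
      ≡⟨ cong (n ℕ.*_) (∑-+ xs _ _) ⟨
    n ℕ.* ∑ xs (λ v → degree v ℕ.+ C v)
      ≤⟨ ℕ.*-monoʳ-≤ n (∑-mono xs shrink) ⟩
    n ℕ.* ∑ xs (λ _ → liveCount ℓ)
      ≡⟨ trans (sym (∑-* xs n _)) (∑-const xs _) ⟩
    length xs ℕ.* (n ℕ.* liveCount ℓ) ∎
    where
    open ℕ.≤-Reasoning
    C degree : Fin n → ℕ
    C v = liveCount (absorb v ℓ)
    degree v = ∑ V (λ x → 𝟙 (live ℓ v) ℕ.* (𝟙 (live ℓ x) ℕ.* mistake false (edge v x)))
    degree-dead : ∀ v → live ℓ v ≡ false → degree v ≡ 0
    degree-dead v dead rewrite dead = ∑-zero V (λ x → refl)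
    shrink : ∀ v → degree v ℕ.+ C v ℕ.≤ liveCount ℓ
    shrink v = ℕ.≤-trans (ℕ.≤-reflexive (sym (∑-+ V _ _))) (∑-mono V pointwise)
      where
      pointwise : ∀ x → 𝟙 (live ℓ v) ℕ.* (𝟙 (live ℓ x) ℕ.* mistake false (edge v x))
                    ℕ.+ 𝟙 (live (absorb v ℓ) x) ℕ.≤ 𝟙 (live ℓ x)
      pointwise x rewrite live-absorb v ℓ x =
        ℕ.≤-trans (ℕ.≤-reflexive (ℕ.+-comm _ (𝟙 (survives (live ℓ v) (live ℓ x) (edge v x)))))
                  (degree-removes (live ℓ v) (live ℓ x) (edge v x))

  -- From charges to the cost of the completed clustering

  edge-nothing : ∀ {x y} → edge x y ≡ nothing → x ≡ y
  edge-nothing {x} {y} eq with x ≟ y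
  ... | yes x≡y = x≡y

  -- The label suc (toℕ x) is reserved for the cluster of pivot x.
  Proper : Clustering n → Set
  Proper ℓ = ∀ x y → live ℓ x ≡ true → ℓ y ≢ suc (toℕ x)

  proper-absorb : ∀ v ℓ → Proper ℓ → Proper (absorb v ℓ)
  proper-absorb v ℓ proper x y x-live with captured (live ℓ v) (live ℓ y) (edge v y)
  ... | true  = λ { eq → contradiction (trans (sym x-live)
                  (subst (λ u → live (absorb v ℓ) u ≡ false)
                    (Fin.toℕ-injective (ℕ.suc-injective eq)) (absorb-pivot-dead v ℓ))) (λ ()) }
  ... | false = proper x y (¬-not (λ dead →
                  contradiction (trans (sym x-live) (absorb-dead v ℓ dead)) (λ ())))

  settledErrors : Clustering n → Fin n → Fin n → ℕ
  settledErrors ℓ x y = settled (live ℓ x) (live ℓ y) (does (ℓ x ℕ.≟ ℓ y)) (edge x y)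

  settledErrors-absorb : ∀ v ℓ → Proper ℓ → ∀ x y →
    settledErrors (absorb v ℓ) x y ℕ.≤ settledErrors ℓ x y ℕ.+ triangle ℓ v x y
  settledErrors-absorb v ℓ proper x y
    rewrite live-absorb v ℓ x | live-absorb v ℓ y
          | if-≟-if (captured (live ℓ v) (live ℓ x) (edge v x)) (captured (live ℓ v) (live ℓ y) (edge v y))
                    (suc (toℕ v)) (ℓ x) (ℓ y)
                    (proper v y ∘ captured⇒pivot (live ℓ v) (live ℓ x) (edge v x))
                    (proper v x ∘ captured⇒pivot (live ℓ v) (live ℓ y) (edge v y))
    = settled-step (live ℓ v) (live ℓ x) (live ℓ y) (does (ℓ x ℕ.≟ ℓ y)) (edge v x) (edge x y) (edge v y)
        (λ eq → cong (λ u → edge u y) (sym (edge-nothing eq)))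
        (λ eq → trans (cong (edge x) (sym (edge-nothing eq))) (edge-sym x v))
        (differ (ℓ x) (ℓ y))
    where
    differ : ∀ p q → ((p ≡ᵇ 0) xor (q ≡ᵇ 0)) ≡ true → does (p ℕ.≟ q) ≡ false
    differ zero    (suc q) eq = refl
    differ (suc p) zero    eq = refl

  charges : List (Fin n) → Clustering n → ℕ
  charges = along charge (λ _ → 0)

  ∑∑-settled-run : ∀ S ℓ → Proper ℓ →
    ∑∑ (settledErrors (run S ℓ)) ℕ.≤ ∑∑ (settledErrors ℓ) ℕ.+ charges S ℓ × Proper (run S ℓ)
  ∑∑-settled-run []      ℓ proper = ℕ.m≤m+n _ 0 , proper
  ∑∑-settled-run (v ∷ S) ℓ proper with ∑∑-settled-run S (absorb v ℓ) (proper-absorb v ℓ proper)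
  ... | bound , proper′ = (begin
    ∑∑ (settledErrors (run S (absorb v ℓ)))
      ≤⟨ bound ⟩
    ∑∑ (settledErrors (absorb v ℓ)) ℕ.+ charges S (absorb v ℓ)
      ≤⟨ ℕ.+-monoˡ-≤ _ (ℕ.≤-trans (∑∑-mono (settledErrors-absorb v ℓ proper))
           (ℕ.≤-reflexive (∑∑-+ (settledErrors ℓ) (triangle ℓ v)))) ⟩
    ∑∑ (settledErrors ℓ) ℕ.+ charge v ℓ ℕ.+ charges S (absorb v ℓ)
      ≡⟨ ℕ.+-assoc (∑∑ (settledErrors ℓ)) (charge v ℓ) _ ⟩
    ∑∑ (settledErrors ℓ) ℕ.+ charges (v ∷ S) ℓ ∎) , proper′
    where open ℕ.≤-Reasoning

  complete : Clustering n → Clustering n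
  complete ℓ x = if live ℓ x then suc (toℕ x) else ℓ x

  errors-complete : ∀ ℓ → Proper ℓ → ∀ x y → errors (complete ℓ) x y ℕ.≤
    settledErrors ℓ x y ℕ.+ 𝟙 (live ℓ x) ℕ.* (𝟙 (live ℓ y) ℕ.* mistake false (edge x y))
  errors-complete ℓ proper x y = by-value (ℓ x) (ℓ y)
      (λ ℓx≡0 → proper x y (cong (_≡ᵇ 0) ℓx≡0)) (λ ℓy≡0 → proper y x (cong (_≡ᵇ 0) ℓy≡0))
    where
    by-value : ∀ p q → (p ≡ 0 → q ≢ suc (toℕ x)) → (q ≡ 0 → p ≢ suc (toℕ y)) →
      mistake (does ((if p ≡ᵇ 0 then suc (toℕ x) else p) ℕ.≟ (if q ≡ᵇ 0 then suc (toℕ y) else q))) (edge x y)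
        ℕ.≤ settled (p ≡ᵇ 0) (q ≡ᵇ 0) (does (p ℕ.≟ q)) (edge x y)
            ℕ.+ 𝟙 (p ≡ᵇ 0) ℕ.* (𝟙 (q ≡ᵇ 0) ℕ.* mistake false (edge x y))
    by-value zero zero _ _ with toℕ x ℕ.≟ toℕ y
    ... | no x≢y rewrite dec-false (toℕ x ℕ.≟ toℕ y) x≢y =
      ℕ.≤-reflexive (sym (trans (ℕ.*-identityˡ _) (ℕ.*-identityˡ _)))
    ... | yes eq rewrite Fin.toℕ-injective eq | edge-refl y | dec-true (toℕ y ℕ.≟ toℕ y) refl = ℕ.z≤n
    by-value zero (suc q) q≢ _ rewrite dec-false (suc (toℕ x) ℕ.≟ suc q) (q≢ refl ∘ sym) = ℕ.m≤m+n _ _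
    by-value (suc p) zero _ p≢ rewrite dec-false (suc p ℕ.≟ suc (toℕ y)) (p≢ refl) = ℕ.m≤m+n _ _
    by-value (suc p) (suc q) _ _ = ℕ.m≤m+n _ _

  blank : Clustering n
  blank _ = 0

  cost≤ : ∀ {ℓ} S → (∀ x → ℓ x ≡ complete (run S blank) x) →
          2 ℕ.* cost G ℓ ℕ.≤ charges S blank ℕ.+ livePlus (run S blank)
  cost≤ {ℓ} S ℓ≗ with ∑∑-settled-run S blank (λ _ _ _ ())
  ... | bound , proper = begin
    2 ℕ.* cost G ℓ
      ≡⟨ ∑∑-errors ℓ ⟨
    ∑∑ (errors ℓ)
      ≡⟨ ∑-cong V (λ x → ∑-cong V (λ y →
           cong₂ (λ p q → mistake (does (p ℕ.≟ q)) (edge x y)) (ℓ≗ x) (ℓ≗ y))) ⟩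
    ∑∑ (errors (complete (run S blank)))
      ≤⟨ ℕ.≤-trans (∑∑-mono (errors-complete (run S blank) proper)) (ℕ.≤-reflexive (∑∑-+ _ _)) ⟩
    ∑∑ (settledErrors (run S blank)) ℕ.+ livePlus (run S blank)
      ≤⟨ ℕ.+-monoˡ-≤ _ bound ⟩
    ∑∑ (settledErrors blank) ℕ.+ charges S blank ℕ.+ livePlus (run S blank)
      ≡⟨ cong (λ t → t ℕ.+ charges S blank ℕ.+ livePlus (run S blank))
              (∑-zero V (λ x → ∑-zero V (λ y → refl))) ⟩
    charges S blank ℕ.+ livePlus (run S blank) ∎
    where open ℕ.≤-Reasoning

  -- livePlus never increases, so its value after the last draw is at most its average over the run.
  livePlus-run : ∀ S ℓ → suc (length S) ℕ.* livePlus (run S ℓ) ℕ.≤ along (λ _ → livePlus) livePlus S ℓ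
    × livePlus (run S ℓ) ℕ.≤ livePlus ℓ
  livePlus-run []      ℓ = ℕ.≤-reflexive (ℕ.*-identityˡ _) , ℕ.≤-refl
  livePlus-run (v ∷ S) ℓ with livePlus-run S (absorb v ℓ)
  ... | bound , final≤ = ℕ.+-mono-≤ final≤′ bound , final≤′
    where final≤′ = ℕ.≤-trans final≤ (livePlus-absorb v ℓ)

  -- Sums over the sample space

  pending-blank : Pending V blank
  pending-blank = record { size≤ = ℕ.≤-reflexive length-V ; ∑-live = λ _ _ → refl }

  -- The 6 is the approximation factor 3 times the double count of ordered pairs.
  ∑-charges≤ : ∀ m j o →
    ∑ (samples m j V) (λ S → charges S blank) ℕ.≤ length (samples m j V) ℕ.* (6 ℕ.* cost G o)
  ∑-charges≤ m j o = begin
    ∑ (samples m j V) (λ S → charges S blank)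
      ≤⟨ Drift.∑-along≤ m Pending (pending-step m) charge (λ _ → 0) (λ ℓ → 3 ℕ.* liveErrors o ℓ)
           (λ _ → ℕ.z≤n) (charge-drift o) j pending-blank ⟩
    length (samples m j V) ℕ.* (3 ℕ.* liveErrors o blank)
      ≡⟨ cong (λ t → length (samples m j V) ℕ.* (3 ℕ.* t))
           (trans (∑-cong V (λ x → ∑-cong V (λ y → trans (ℕ.*-identityˡ _) (ℕ.*-identityˡ _)))) (∑∑-errors o)) ⟩
    length (samples m j V) ℕ.* (3 ℕ.* (2 ℕ.* cost G o))
      ≡⟨ cong (length (samples m j V) ℕ.*_) (ℕ.*-assoc 3 2 (cost G o)) ⟨
    length (samples m j V) ℕ.* (6 ℕ.* cost G o) ∎
    where open ℕ.≤-Reasoning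

  ∑-livePlus≤ : ∀ m j →
    suc j ℕ.* ∑ (samples m j V) (λ S → livePlus (run S blank)) ℕ.≤ length (samples m j V) ℕ.* (n ℕ.* n)
  ∑-livePlus≤ m j = begin
    suc j ℕ.* ∑ (samples m j V) (λ S → livePlus (run S blank))
      ≡⟨ ∑-* (samples m j V) (suc j) _ ⟨
    ∑ (samples m j V) (λ S → suc j ℕ.* livePlus (run S blank))
      ≤⟨ ∑-mono-∈ (samples m j V) (λ {S} S∈ → subst (λ i → suc i ℕ.* livePlus (run S blank) ℕ.≤ _)
           (length-sample m j V S∈) (proj₁ (livePlus-run S blank))) ⟩
    ∑ (samples m j V) (λ S → along (λ _ → livePlus) livePlus S blank)
      ≤⟨ Drift.∑-along≤ m Pending (pending-step m) (λ _ → livePlus) livePlus (λ ℓ → n ℕ.* liveCount ℓ)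
           livePlus≤ livePlus-drift j pending-blank ⟩
    length (samples m j V) ℕ.* (n ℕ.* liveCount blank)
      ≡⟨ cong (λ t → length (samples m j V) ℕ.* (n ℕ.* t)) (trans (sym (length-∑ V)) length-V) ⟩
    length (samples m j V) ℕ.* (n ℕ.* n) ∎
    where open ℕ.≤-Reasoning

  -- Once no draws are pending, `∑-live` equates the number of live vertices with an empty sum.
  liveCount-exhausted : ∀ j xs ℓ {S} → Pending xs ℓ → length xs ≡ j → S ∈ samples withoutReplacement j xs →
                        liveCount (run S ℓ) ≡ 0
  liveCount-exhausted zero    []  ℓ P _     (here refl) =
    sym (∑-live P (λ x → 𝟙 (live ℓ x)) (λ _ dead → cong 𝟙 dead))
  liveCount-exhausted (suc j) xs  ℓ P size  S∈ with ∈-samples⁻ withoutReplacement j xs S∈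
  ... | v , rest , S′ , p , S′∈ , refl = liveCount-exhausted j rest (absorb v ℓ)
    (pending-step withoutReplacement P p)
    (trans (length-rest withoutReplacement xs p) (cong pred size)) S′∈

  livePlus-exhausted : ∀ {S} → S ∈ samples withoutReplacement n V → livePlus (run S blank) ≡ 0
  livePlus-exhausted {S} S∈ = ℕ.n≤0⇒n≡0 (ℕ.≤-trans (livePlus≤ (run S blank)) (ℕ.≤-reflexive
    (trans (cong (n ℕ.*_) (liveCount-exhausted n V blank pending-blank length-V S∈)) (ℕ.*-zeroʳ n))))

  -- The cost of the output

  answers : List (Pair n) → List (Pair n × Sign)
  answers = map (λ (x , y) → (x , y) , label x y)

  record Sound (plus : Matrix Bool n) : Set where
    constructor sound
    field positive : ∀ v w → plus v w ≡ true → label v w ≡ Sign.+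

  storeAnswers-sound : ∀ qs → Sound (value (storeAnswers (answers qs)))
  storeAnswers-sound qs = forEach-invariant Sound (answers qs)
    (λ { {_ , Sign.-} _ plus inv → inv
       ; {(x , y) , Sign.+} a∈ plus inv → mark x y plus (is-plus a∈) inv })
    (sound (λ _ _ ()))
    where
    is-plus : ∀ {x y} → ((x , y) , Sign.+) ∈ answers qs → label x y ≡ Sign.+
    is-plus a∈ with ∈-map⁻ _ a∈
    ... | _ , _ , eq with ,-injective eq
    ...   | refl , +≡label = sym +≡label
    mark : ∀ x y plus → label x y ≡ Sign.+ → Sound plus →
           Sound (value (write₂ (value (write₂ plus x y true)) y x true))
    mark x y plus xy+ (sound positive) = sound positive′
      where
      positive′ : ∀ v w → value (write₂ (value (write₂ plus x y true)) y x true) v w ≡ true →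
                  label v w ≡ Sign.+
      positive′ v w eq with write₂-true (value (write₂ plus x y true)) y x eq
      ... | inj₁ (refl , refl) = trans (label-sym y x) xy+
      ... | inj₂ eq′ with write₂-true plus x y eq′
      ...   | inj₁ (refl , refl) = xy+
      ...   | inj₂ eq″           = positive v w eq″

  Marked : Pair n × Sign → Matrix Bool n → Set
  Marked ((x , y) , t) plus = t ≡ Sign.+ → plus x y ≡ true × plus y x ≡ true

  storeAnswers-marks : ∀ as {a} → a ∈ as → Marked a (value (storeAnswers as))
  storeAnswers-marks as = forEach-visits Marked as
    (λ { ((x , y) , Sign.+) plus _ →
           write₂-keeps (value (write₂ plus x y true)) y x (write₂-at plus x y)
         , write₂-at (value (write₂ plus x y true)) y x
       ; (_ , Sign.-) plus () })
    (λ { (_ , Sign.-) _ plus marked → marked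
       ; ((x , y) , Sign.+) _ plus marked t+ →
           keeps plus x y (proj₁ (marked t+)) , keeps plus x y (proj₂ (marked t+)) })
    where
    keeps : ∀ plus x y {v w} → plus v w ≡ true →
            value (write₂ (value (write₂ plus x y true)) y x true) v w ≡ true
    keeps plus x y eq = write₂-keeps (value (write₂ plus x y true)) y x (write₂-keeps plus x y eq)

  -- Only the rows of sampled vertices are fully known, and the diagonal is never queried. The
  -- clustering loop reads exactly such rows, and labels the pivot itself before reading.
  RowsStored : List (Fin n) → Matrix Bool n → Set
  RowsStored S plus = ∀ {v w} → v ∈ S → v ≢ w → plus v w ≡ joins (edge v w)

  rows-stored : ∀ S → RowsStored S (value (storeAnswers (answers (value (plan S)))))
  rows-stored S {v} {w} v∈S v≢w rewrite edge-≢ v≢w with label v w in eq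
  ... | Sign.- = ¬-not (λ vw-stored → contradiction
      (trans (sym eq) (Sound.positive (storeAnswers-sound (value (plan S))) v w vw-stored)) (λ ()))
  ... | Sign.+ with asked-complete S v∈S v≢w
  ...   | inj₁ vw∈ = proj₁ (storeAnswers-marks (answers (value (plan S)))
                              (∈-map⁺ (λ (x , y) → (x , y) , label x y) vw∈) eq)
  ...   | inj₂ wv∈ = proj₂ (storeAnswers-marks (answers (value (plan S)))
                              (∈-map⁺ (λ (x , y) → (x , y) , label x y) wv∈) (trans (label-sym w v) eq))

  absorb-cong : ∀ v {ℓ ℓ′} → (∀ x → ℓ x ≡ ℓ′ x) → ∀ x → absorb v ℓ x ≡ absorb v ℓ′ x
  absorb-cong v ℓ≗ x rewrite ℓ≗ v | ℓ≗ x = refl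

  forEach-run : ∀ {body : Fin n → Clustering n → Timed (Clustering n)} S {ℓ ℓ′} →
    (∀ {v} → v ∈ S → ∀ ℓ x → value (body v ℓ) x ≡ absorb v ℓ x) → (∀ x → ℓ x ≡ ℓ′ x) →
    ∀ x → value (forEach S body ℓ) x ≡ run S ℓ′ x
  forEach-run []      body≗ ℓ≗ = ℓ≗
  forEach-run (v ∷ S) body≗ ℓ≗ = forEach-run S (body≗ ∘ there)
    (λ x → trans (body≗ (here refl) _ x) (absorb-cong v ℓ≗ x))

  relabel : Bool → ℕ → ℕ → ℕ
  relabel p c a = if p ∧ (a ≡ᵇ 0) then suc c else a

  relabel-idem : ∀ p c a → relabel p c (relabel p c a) ≡ relabel p c a
  relabel-idem false c a       = refl
  relabel-idem true  c zero    = refl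
  relabel-idem true  c (suc a) = refl

  pivot-relabels : ∀ {v} (plus : Matrix Bool n) ℓ → live ℓ v ≡ true →
    (∀ {w} → v ≢ w → plus v w ≡ joins (edge v w)) → ∀ x →
    relabel (plus v x) (toℕ v) (updateAt ℓ v (const (suc (toℕ v))) x) ≡ absorb v ℓ x
  pivot-relabels {v} plus ℓ v-live stored x with x ≟ v
  ... | no x≢v rewrite updateAt-minimal x v {const (suc (toℕ v))} ℓ x≢v | stored (x≢v ∘ sym) | v-live =
    if-cong (∧-comm (joins (edge v x)) (live ℓ x))
  -- The pivot already carries its nonzero label, so the value stored at `plus v v` has no effect.
  ... | yes refl rewrite updateAt-updates v {const (suc (toℕ v))} ℓ | v-live | edge-refl v =
    if-eta (plus v v ∧ false)

  pivot-run : ∀ S plus → RowsStored S plus → ∀ x → value (pivot S plus) x ≡ run S blank x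
  pivot-run S plus stored = forEach-run S
    (λ {v} v∈S ℓ x → if-elim (λ (t : Timed (Clustering n)) → value t x ≡ absorb v ℓ x) (live ℓ v)
      (λ v-live → trans
        (forEach-pointwise (λ w → relabel (plus v w) (toℕ v)) (λ w → relabel-idem (plus v w) (toℕ v))
          (λ u a → trans (if-float (λ (t : Timed (Clustering n)) → value t u) (plus v u ∧ (a u ≡ᵇ 0)))
                         (if-cong-then (plus v u ∧ (a u ≡ᵇ 0)) (updateAt-updates u a)))
          (λ {u} {w} a u≢w → if-elim (λ (t : Timed (Clustering n)) → value t u ≡ a u) (plus v w ∧ (a w ≡ᵇ 0))
            (λ _ → updateAt-minimal u w a u≢w) (λ _ → refl))
          V (inj₁ (∈-allFin x)))
        (pivot-relabels plus ℓ v-live (stored v∈S) x))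
      (λ v-dead → cong (λ b → if captured b (live ℓ x) (edge v x) then suc (toℕ v) else ℓ x) (sym v-dead)))
    (λ _ → refl)

  singletons-complete : ∀ ℓ x → value (singletons ℓ) x ≡ complete ℓ x
  singletons-complete ℓ x = forEach-pointwise (relabel true ∘ toℕ) (relabel-idem true ∘ toℕ)
    (λ u a → trans (if-float (λ (t : Timed (Clustering n)) → value t u) (a u ≡ᵇ 0))
                   (if-cong-then (a u ≡ᵇ 0) (updateAt-updates u a)))
    (λ {u} {w} a u≢w → if-elim (λ (t : Timed (Clustering n)) → value t u ≡ a u) (a w ≡ᵇ 0)
      (λ _ → updateAt-minimal u w a u≢w) (λ _ → refl))
    V (inj₁ (∈-allFin x))

  output-complete : ∀ S x → NonAdaptive.output (qecc S) G x ≡ complete (run S blank) x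
  output-complete S x = trans (singletons-complete _ x)
    (cong (λ a → if a ≡ᵇ 0 then suc (toℕ x) else a) (pivot-run S _ (rows-stored S) x))

  -- Running time

  -- Per sample: one tick, one read and one write of its mark, then `n` inner iterations of a tick
  -- and a read each.
  plan-steps : ∀ S → steps (plan {n} S) ℕ.≤ length S ℕ.* (3 ℕ.+ n ℕ.* 2)
  plan-steps S = ℕ.≤-trans (ℕ.≤-reflexive (ℕ.+-identityʳ _))
    (forEach-steps (2 ℕ.+ n ℕ.* 2) S (λ v (b , qs) →
      ℕ.s≤s (if-elim (λ t → steps t ℕ.≤ suc (n ℕ.* 2)) (b v)
        (λ _ → ℕ.z≤n)
        (λ _ → ℕ.s≤s (ℕ.≤-trans (ℕ.≤-reflexive (ℕ.+-identityʳ _))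
          (ℕ.≤-trans (forEach-steps 1 V (λ _ _ → ℕ.≤-refl)) (ℕ.≤-reflexive (cong (ℕ._* 2) length-V))))))))

  storeAnswers-steps : ∀ as → steps (storeAnswers {n} as) ℕ.≤ length as ℕ.* 3
  storeAnswers-steps as = forEach-steps 2 as
    (λ { (_ , Sign.-) _ → ℕ.z≤n ; (_ , Sign.+) _ → ℕ.≤-refl })

  -- An inner iteration costs a tick, two reads and at most one write.
  pivot-steps : ∀ S plus → steps (pivot {n} S plus) ℕ.≤ length S ℕ.* (3 ℕ.+ n ℕ.* 4)
  pivot-steps S plus = forEach-steps (2 ℕ.+ n ℕ.* 4) S (λ v ℓ →
    ℕ.s≤s (if-elim (λ t → steps t ℕ.≤ suc (n ℕ.* 4)) (live ℓ v)
      (λ _ → ℕ.s≤s (ℕ.≤-trans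
        (forEach-steps 3 V (λ w a → ℕ.s≤s (ℕ.s≤s
          (if-elim (λ t → steps t ℕ.≤ 1) (plus v w ∧ (a w ≡ᵇ 0)) (λ _ → ℕ.≤-refl) (λ _ → ℕ.z≤n)))))
        (ℕ.≤-reflexive (cong (ℕ._* 4) length-V))))
      (λ _ → ℕ.z≤n)))

  singletons-steps : ∀ ℓ → steps (singletons {n} ℓ) ℕ.≤ n ℕ.* 3
  singletons-steps ℓ = ℕ.≤-trans
    (forEach-steps 2 V (λ v a → ℕ.s≤s
      (if-elim (λ t → steps t ℕ.≤ 1) (a v ≡ᵇ 0) (λ _ → ℕ.≤-refl) (λ _ → ℕ.z≤n))))
    (ℕ.≤-reflexive (cong (ℕ._* 3) length-V))

-- Rational bounds

toℚᵘ-/ : ∀ m d → ℚ.toℚᵘ (ℤ.+ m ℚ./ suc d) ℚᵘ.≃ ℚᵘ.mkℚᵘ (ℤ.+ m) d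
toℚᵘ-/ m d = ℚ.toℚᵘ-fromℚᵘ (ℚᵘ.mkℚᵘ (ℤ.+ m) d)

ι-mono : ∀ {a b} → a ℕ.≤ b → ι a ≤ ι b
ι-mono {a} {b} a≤b = ℚ.toℚᵘ-cancel-≤
  (ℚᵘ.≤-respˡ-≃ (ℚᵘ.≃-sym (toℚᵘ-/ a 0)) (ℚᵘ.≤-respʳ-≃ (ℚᵘ.≃-sym (toℚᵘ-/ b 0))
    (ℚᵘ.*≤* (ℤ.*-monoʳ-≤-nonNeg (ℤ.+ 1) (ℤ.+≤+ a≤b)))))

ι-+ : ∀ a b → ι (a ℕ.+ b) ≡ ι a + ι b
ι-+ a b = ℚ.toℚᵘ-injective (begin-equality
  ℚ.toℚᵘ (ι (a ℕ.+ b))                       ≃⟨ toℚᵘ-/ (a ℕ.+ b) 0 ⟩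
  ℚᵘ.mkℚᵘ (ℤ.+ (a ℕ.+ b)) 0                    ≃⟨ ℚᵘ.*≡* (cong (ℤ._* ℤ.+ 1)
    (trans (ℤ.pos-+ a b) (sym (cong₂ ℤ._+_ (ℤ.*-identityʳ (ℤ.+ a)) (ℤ.*-identityʳ (ℤ.+ b)))))) ⟩
  ℚᵘ.mkℚᵘ (ℤ.+ a) 0 ℚᵘ.+ ℚᵘ.mkℚᵘ (ℤ.+ b) 0       ≃⟨ ℚᵘ.+-cong (toℚᵘ-/ a 0) (toℚᵘ-/ b 0) ⟨
  ℚ.toℚᵘ (ι a) ℚᵘ.+ ℚ.toℚᵘ (ι b)             ≃⟨ ℚ.toℚᵘ-homo-+ (ι a) (ι b) ⟨
  ℚ.toℚᵘ (ι a + ι b)                         ∎)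
  where open ℚᵘ.≤-Reasoning

ι-* : ∀ a b → ι (a ℕ.* b) ≡ ι a * ι b
ι-* a b = ℚ.toℚᵘ-injective (begin-equality
  ℚ.toℚᵘ (ι (a ℕ.* b))                       ≃⟨ toℚᵘ-/ (a ℕ.* b) 0 ⟩
  ℚᵘ.mkℚᵘ (ℤ.+ (a ℕ.* b)) 0                    ≃⟨ ℚᵘ.*≡* (cong (ℤ._* ℤ.+ 1) (ℤ.pos-* a b)) ⟩
  ℚᵘ.mkℚᵘ (ℤ.+ a) 0 ℚᵘ.* ℚᵘ.mkℚᵘ (ℤ.+ b) 0       ≃⟨ ℚᵘ.*-cong (toℚᵘ-/ a 0) (toℚᵘ-/ b 0) ⟨
  ℚ.toℚᵘ (ι a) ℚᵘ.* ℚ.toℚᵘ (ι b)             ≃⟨ ℚ.toℚᵘ-homo-* (ι a) (ι b) ⟨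
  ℚ.toℚᵘ (ι a * ι b)                         ∎)
  where open ℚᵘ.≤-Reasoning

ι-nonNeg : ∀ a → ℚ.NonNegative (ι a)
ι-nonNeg a = ℚ.nonNegative (ι-mono {0} {a} ℕ.z≤n)

/-*-ι : ∀ m d → (ℤ.+ m ℚ./ suc d) * ι (suc d) ≡ ι m
/-*-ι m d = ℚ.toℚᵘ-injective (begin-equality
  ℚ.toℚᵘ ((ℤ.+ m ℚ./ suc d) * ι (suc d))           ≃⟨ ℚ.toℚᵘ-homo-* (ℤ.+ m ℚ./ suc d) (ι (suc d)) ⟩
  ℚ.toℚᵘ (ℤ.+ m ℚ./ suc d) ℚᵘ.* ℚ.toℚᵘ (ι (suc d)) ≃⟨ ℚᵘ.*-cong (toℚᵘ-/ m d) (toℚᵘ-/ (suc d) 0) ⟩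
  ℚᵘ.mkℚᵘ (ℤ.+ m) d ℚᵘ.* ℚᵘ.mkℚᵘ (ℤ.+ suc d) 0       ≃⟨ ℚᵘ.*≡* (ℤ.*-assoc (ℤ.+ m) (ℤ.+ suc d) (ℤ.+ 1)) ⟩
  ℚᵘ.mkℚᵘ (ℤ.+ m) 0                                ≃⟨ toℚᵘ-/ m 0 ⟨
  ℚ.toℚᵘ (ι m)                                   ∎)
  where open ℚᵘ.≤-Reasoning

-- Nonnegativity of `b` covers the dummy value of `mean` on the empty list.
mean≤ : ∀ xs {b} → 0ℚ ≤ b → ι (sum xs) ≤ ι (length xs) * b → mean xs ≤ b
mean≤ []           0≤b _     = 0≤b
mean≤ xs@(x ∷ xs′) {b} _ sum≤ = ℚ.*-cancelʳ-≤-pos (ι (length xs))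
  (subst₂ _≤_ (sym (/-*-ι (sum xs) (length xs′))) (ℚ.*-comm (ι (length xs)) b) sum≤)
  where instance _ = ℚ.normalize-pos (length xs) 1

-- Every iteration raises the counter, except a failing one, which is the last.
search-steps : ∀ n Q fuel t → steps (search n Q fuel t) ℕ.+ t ℕ.≤ suc (value (search n Q fuel t))
search-steps n Q zero       t = ℕ.n≤1+n t
search-steps n Q (suc fuel) t =
  if-elim (λ s → suc (steps s ℕ.+ t) ℕ.≤ suc (value s)) (does (feasible? n Q (suc t)))
    (λ _ → subst (ℕ._≤ suc (value (search n Q fuel (suc t)))) (ℕ.+-suc (steps (search n Q fuel (suc t))) t)
             (search-steps n Q fuel (suc t)))
    (λ _ → ℕ.≤-refl)

t≤n*t : ∀ n t → t ℕ.≤ n → t ℕ.≤ n ℕ.* t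
t≤n*t zero    .zero ℕ.z≤n = ℕ.z≤n
t≤n*t (suc n) t     _     = ℕ.m≤m+n t (n ℕ.* t)

-- For n ≥ 2 the first factor on the right is at least n - 1 ≥ n/2. The final 1 is for n = t = 1,
-- where a vertex is sampled but there is no pair to query.
n*t≤ : ∀ n t → t ℕ.≤ n → n ℕ.* t ℕ.≤ 2 ℕ.* ((2 ℕ.* n ℕ.∸ 1 ℕ.∸ t) ℕ.* t) ℕ.+ 1
n*t≤ zero          t t≤n = ℕ.z≤n
n*t≤ (suc zero)    t t≤1 = ℕ.≤-trans (ℕ.≤-reflexive (ℕ.*-identityˡ t)) (ℕ.≤-trans t≤1 (ℕ.m≤n+m 1 _))
n*t≤ n@(suc (suc i)) t t≤n = ℕ.m≤n⇒m≤n+o 1 (begin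
  n ℕ.* t                                 ≤⟨ ℕ.*-monoˡ-≤ t (ℕ.s≤s (ℕ.m≤n+m (suc i) i)) ⟩
  (suc i ℕ.+ suc i) ℕ.* t                 ≡⟨ cong (λ j → (suc i ℕ.+ j) ℕ.* t) (ℕ.+-identityʳ (suc i)) ⟨
  2 ℕ.* suc i ℕ.* t                       ≤⟨ ℕ.*-monoˡ-≤ t (ℕ.*-monoʳ-≤ 2 rest≥) ⟩
  2 ℕ.* (2 ℕ.* n ℕ.∸ 1 ℕ.∸ t) ℕ.* t       ≡⟨ ℕ.*-assoc 2 (2 ℕ.* n ℕ.∸ 1 ℕ.∸ t) t ⟩
  2 ℕ.* ((2 ℕ.* n ℕ.∸ 1 ℕ.∸ t) ℕ.* t)     ∎)
  where
  open ℕ.≤-Reasoning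
  rest≥ : suc i ℕ.≤ 2 ℕ.* n ℕ.∸ 1 ℕ.∸ t
  rest≥ = begin
    suc i                   ≡⟨ ℕ.m+n∸n≡m (suc i) n ⟨
    suc i ℕ.+ n ℕ.∸ n       ≤⟨ ℕ.∸-monoʳ-≤ (suc i ℕ.+ n) t≤n ⟩
    suc i ℕ.+ n ℕ.∸ t       ≡⟨ cong (λ j → suc i ℕ.+ j ℕ.∸ t) (ℕ.+-identityʳ n) ⟨
    2 ℕ.* n ℕ.∸ 1 ℕ.∸ t     ∎

module _ (Q : ℚ) .{{_ : Positive Q}} where

  private instance
    2Q-pos : Positive (ι 2 * Q)
    2Q-pos = ℚ.pos*pos⇒pos (ι 2) Q

  slack-* : ∀ n → slack n Q * (ι 2 * Q) ≡ ι (n ℕ.^ 3)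
  slack-* n = trans (ℚ.*-assoc (ι (n ℕ.^ 3)) _ (ι 2 * Q))
    (trans (cong (ι (n ℕ.^ 3) *_) (ℚ.*-inverseˡ (ι 2 * Q))) (ℚ.*-identityʳ (ι (n ℕ.^ 3))))
    where instance _ = ℚ.pos⇒nonZero (ι 2 * Q)

  slack≥0 : ∀ n → 0ℚ ≤ slack n Q
  slack≥0 n = ℚ.*-cancelʳ-≤-pos (ι 2 * Q)
    (subst₂ _≤_ (sym (ℚ.*-zeroˡ (ι 2 * Q))) (sym (slack-* n)) (ι-mono {0} {n ℕ.^ 3} ℕ.z≤n))

  findK-steps : ∀ n → steps (findK n Q) ℕ.≤ suc (k n Q)
  findK-steps n = subst (ℕ._≤ suc (k n Q)) (ℕ.+-identityʳ _) (search-steps n Q n 0)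

  k≤n : ∀ n → k n Q ℕ.≤ n
  k≤n n = proj₁ (k-max n Q)

  pairs-through-k≤ : ∀ n → ι ((2 ℕ.* n ℕ.∸ 1 ℕ.∸ k n Q) ℕ.* k n Q) ≤ ι 2 * Q
  pairs-through-k≤ n = proj₁ (proj₂ (k-max n Q))

  2Q≤ : ∀ n → k n Q ℕ.< n → ι 2 * Q ≤ ι (2 ℕ.* n ℕ.* suc (k n Q))
  2Q≤ n k<n = ℚ.≤-trans
    (ℚ.<⇒≤ (ℚ.≰⇒> (λ feasible →
      ℕ.<-irrefl refl (proj₂ (proj₂ (k-max n Q)) (suc (k n Q)) k<n feasible))))
    (ι-mono (ℕ.*-monoˡ-≤ (suc (k n Q))
      (ℕ.≤-trans (ℕ.m∸n≤m _ (suc (k n Q))) (ℕ.m∸n≤m (2 ℕ.* n) 1))))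

  -- `p` stands for the leftover edges summed over `w` samples and counted twice, hence the 2w.
  -- Multiplying by 2Q clears the denominator of `slack`.
  ≤-slack : ∀ n j w p → suc j ℕ.* p ℕ.≤ w ℕ.* (n ℕ.* n) → ι 2 * Q ≤ ι (2 ℕ.* n ℕ.* suc j) →
            ι p ≤ ι (2 ℕ.* w) * slack n Q
  ≤-slack n j w p p≤ 2Q≤ = ℚ.*-cancelʳ-≤-pos (ι 2 * Q) (begin
    ι p * (ι 2 * Q)                           ≤⟨ ℚ.*-monoˡ-≤-nonNeg (ι p) {{ι-nonNeg p}} 2Q≤ ⟩
    ι p * ι (2 ℕ.* n ℕ.* suc j)               ≡⟨ ι-* p (2 ℕ.* n ℕ.* suc j) ⟨
    ι (p ℕ.* (2 ℕ.* n ℕ.* suc j))             ≤⟨ ι-mono cubic ⟩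
    ι (2 ℕ.* w ℕ.* n ℕ.^ 3)                   ≡⟨ ι-* (2 ℕ.* w) (n ℕ.^ 3) ⟩
    ι (2 ℕ.* w) * ι (n ℕ.^ 3)                 ≡⟨ cong (ι (2 ℕ.* w) *_) (slack-* n) ⟨
    ι (2 ℕ.* w) * (slack n Q * (ι 2 * Q))     ≡⟨ ℚ.*-assoc (ι (2 ℕ.* w)) (slack n Q) (ι 2 * Q) ⟨
    ι (2 ℕ.* w) * slack n Q * (ι 2 * Q)       ∎)
    where
    open ℚ.≤-Reasoning
    cubic : p ℕ.* (2 ℕ.* n ℕ.* suc j) ℕ.≤ 2 ℕ.* w ℕ.* n ℕ.^ 3
    cubic = ℕR.begin
      p ℕ.* (2 ℕ.* n ℕ.* suc j)
        ℕR.≡⟨ solve 3 (λ p n j → p :* (con 2 :* n :* j) := con 2 :* n :* (j :* p)) refl p n (suc j) ⟩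
      2 ℕ.* n ℕ.* (suc j ℕ.* p)
        ℕR.≤⟨ ℕ.*-monoʳ-≤ (2 ℕ.* n) p≤ ⟩
      2 ℕ.* n ℕ.* (w ℕ.* (n ℕ.* n))
        ℕR.≡⟨ solve 2 (λ n w → con 2 :* n :* (w :* (n :* n)) := con 2 :* w :* (n :^ 3)) refl n w ⟩
      2 ℕ.* w ℕ.* n ℕ.^ 3 ℕR.∎
      where
      module ℕR = ℕ.≤-Reasoning
      open +-*-Solver

  -- Expected cost, number of queries and running time

  module _ {n : ℕ} (G : LabelledGraph n) where
    open Analysis G

    leftover : Sampling → ℕ
    leftover m = ∑ (sampleSpace G Q m) (λ S → livePlus (run S blank))

    expectedCost≤ : ∀ m {opt} → IsOPT G opt →
      ι (leftover m) ≤ ι (2 ℕ.* length (sampleSpace G Q m)) * slack n Q →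
      expectedCost G Q m ≤ ι 3 * ι opt + slack n Q
    expectedCost≤ m {opt} ((o , refl) , _) leftover≤ = mean≤ (map F Ss) 0≤b
      (subst (λ l → ι (∑ Ss F) ≤ ι l * b) (sym (List.length-map F Ss))
        (ℚ.*-cancelˡ-≤-pos (ι 2) (begin
          ι 2 * ι (∑ Ss F)                        ≡⟨ ι-* 2 (∑ Ss F) ⟨
          ι (2 ℕ.* ∑ Ss F)                        ≤⟨ ι-mono total ⟩
          ι (2 ℕ.* w ℕ.* (3 ℕ.* cost G o) ℕ.+ leftover m)
            ≡⟨ trans (ι-+ (2 ℕ.* w ℕ.* (3 ℕ.* cost G o)) (leftover m))
                 (cong (_+ ι (leftover m)) (trans (ι-* (2 ℕ.* w) (3 ℕ.* cost G o))
                   (cong (ι (2 ℕ.* w) *_) (ι-* 3 (cost G o))))) ⟩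
          ι (2 ℕ.* w) * (ι 3 * ι (cost G o)) + ι (leftover m)
            ≤⟨ ℚ.+-monoʳ-≤ (ι (2 ℕ.* w) * (ι 3 * ι (cost G o))) leftover≤ ⟩
          ι (2 ℕ.* w) * (ι 3 * ι (cost G o)) + ι (2 ℕ.* w) * slack n Q
            ≡⟨ ℚ.*-distribˡ-+ (ι (2 ℕ.* w)) _ _ ⟨
          ι (2 ℕ.* w) * b                         ≡⟨ cong (_* b) (ι-* 2 w) ⟩
          ι 2 * ι w * b                           ≡⟨ ℚ.*-assoc (ι 2) (ι w) b ⟩
          ι 2 * (ι w * b)                         ∎)))
      where
      open ℚ.≤-Reasoning
      Ss = sampleSpace G Q m
      w = length Ss
      b = ι 3 * ι (cost G o) + slack n Q
      F : List (Fin n) → ℕ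
      F S = cost G (NonAdaptive.output (qecc S) G)
      0≤b : 0ℚ ≤ b
      0≤b = ℚ.+-mono-≤ (subst (0ℚ ≤_) (ι-* 3 (cost G o)) (ι-mono {0} {3 ℕ.* cost G o} ℕ.z≤n)) (slack≥0 n)
      total : 2 ℕ.* ∑ Ss F ℕ.≤ 2 ℕ.* w ℕ.* (3 ℕ.* cost G o) ℕ.+ leftover m
      total = ℕR.begin
        2 ℕ.* ∑ Ss F
          ℕR.≡⟨ ∑-* Ss 2 F ⟨
        ∑ Ss (λ S → 2 ℕ.* F S)
          ℕR.≤⟨ ∑-mono Ss (λ S → cost≤ S (output-complete S)) ⟩
        ∑ Ss (λ S → charges S blank ℕ.+ livePlus (run S blank))
          ℕR.≡⟨ ∑-+ Ss (λ S → charges S blank) (λ S → livePlus (run S blank)) ⟩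
        ∑ Ss (λ S → charges S blank) ℕ.+ leftover m
          ℕR.≤⟨ ℕ.+-monoˡ-≤ (leftover m) (∑-charges≤ m (k n Q) o) ⟩
        w ℕ.* (6 ℕ.* cost G o) ℕ.+ leftover m
          ℕR.≡⟨ cong (ℕ._+ leftover m)
                 (solve 2 (λ w c → w :* (con 6 :* c) := con 2 :* w :* (con 3 :* c)) refl w (cost G o)) ⟩
        2 ℕ.* w ℕ.* (3 ℕ.* cost G o) ℕ.+ leftover m ℕR.∎
        where
        module ℕR = ℕ.≤-Reasoning
        open +-*-Solver

    leftover≤ : ∀ m → ι 2 * Q ≤ ι (2 ℕ.* n ℕ.* suc (k n Q)) →
      ι (leftover m) ≤ ι (2 ℕ.* length (sampleSpace G Q m)) * slack n Q
    leftover≤ m = ≤-slack n (k n Q) (length (sampleSpace G Q m)) (leftover m) (∑-livePlus≤ m (k n Q))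

    leftover-exhausted : k n Q ≡ n → leftover withoutReplacement ≡ 0
    leftover-exhausted k≡n = trans
      (∑-cong-∈ (sampleSpace G Q withoutReplacement) (λ {S} S∈ →
        livePlus-exhausted (subst (λ j → S ∈ samples withoutReplacement j (allFin n)) k≡n S∈)))
      (∑-zero (sampleSpace G Q withoutReplacement) (λ _ → refl))

    cost-withoutReplacement : ∀ opt → IsOPT G opt →
      expectedCost G Q withoutReplacement ≤ ι 3 * ι opt + slack n Q
    cost-withoutReplacement opt isOPT with ℕ.m≤n⇒m<n∨m≡n (k≤n n)
    ... | inj₁ k<n = expectedCost≤ withoutReplacement isOPT (leftover≤ withoutReplacement (2Q≤ n k<n))
    ... | inj₂ k≡n = expectedCost≤ withoutReplacement isOPT
      (subst (λ p → ι p ≤ ι w * slack n Q) (sym (leftover-exhausted k≡n))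
        (subst (_≤ ι w * slack n Q) (ℚ.*-zeroʳ (ι w)) (ℚ.*-monoˡ-≤-nonNeg (ι w) {{ι-nonNeg w}} (slack≥0 n))))
      where w = 2 ℕ.* length (sampleSpace G Q withoutReplacement)

    cost-withReplacement : ι 2 * Q ≤ ι (n ℕ.* (n ℕ.∸ 1)) → ∀ opt → IsOPT G opt →
      expectedCost G Q withReplacement ≤ ι 3 * ι opt + slack n Q
    cost-withReplacement 2Q≤pairs opt isOPT with ℕ.m≤n⇒m<n∨m≡n (k≤n n)
    ... | inj₁ k<n = expectedCost≤ withReplacement isOPT (leftover≤ withReplacement (2Q≤ n k<n))
    ... | inj₂ k≡n = expectedCost≤ withReplacement isOPT (leftover≤ withReplacement
      (ℚ.≤-trans 2Q≤pairs (ι-mono (ℕ.*-mono-≤ (ℕ.m≤n*m n 2)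
        (ℕ.≤-trans (ℕ.m∸n≤m n 1) (ℕ.≤-trans (ℕ.≤-reflexive (sym k≡n)) (ℕ.n≤1+n _)))))))

    sample-size : ∀ m {S} → S ∈ sampleSpace G Q m → length S ≡ k n Q
    sample-size m S∈ = length-sample m (k n Q) (allFin n) S∈

    2*queryCount≤ : ∀ m {S} → S ∈ sampleSpace G Q m →
      2 ℕ.* queryCount G Q S ℕ.≤ (2 ℕ.* n ℕ.∸ 1 ℕ.∸ k n Q) ℕ.* k n Q
    2*queryCount≤ m {S} S∈ = 2*asked≤ S (ℕ.≤-reflexive (sample-size m S∈)) (k≤n n)

    queryCount≤ : ∀ m S → S ∈ sampleSpace G Q m → ι (queryCount G Q S) ≤ Q
    queryCount≤ m S S∈ = ℚ.*-cancelˡ-≤-pos (ι 2) (begin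
      ι 2 * ι (queryCount G Q S)      ≡⟨ ι-* 2 (queryCount G Q S) ⟨
      ι (2 ℕ.* queryCount G Q S)      ≤⟨ ι-mono (2*queryCount≤ m S∈) ⟩
      ι ((2 ℕ.* n ℕ.∸ 1 ℕ.∸ k n Q) ℕ.* k n Q) ≤⟨ pairs-through-k≤ n ⟩
      ι 2 * Q                         ∎)
      where open ℚ.≤-Reasoning

    -- All costs are reduced to the quantity that feasibility of `k` bounds by 2Q, through 2q ≤ h
    -- and t ≤ nt ≤ 2h + 1. The constants are 15 = 1 + 8 + 6 and 30 = 16 + 12 + 2.
    runTime-implicit≤ : ∀ m S → S ∈ sampleSpace G Q m → runTime G Q qecc-implicit S ℕ.≤
      15 ℕ.+ 30 ℕ.* ((2 ℕ.* n ℕ.∸ 1 ℕ.∸ k n Q) ℕ.* k n Q)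
    runTime-implicit≤ m S S∈ = begin
      steps (findK n Q) ℕ.+ length S
          ℕ.+ (steps (plan {n} S) ℕ.+ q ℕ.+ (steps (storeAnswers {n} as) ℕ.+ steps (pivot S plus)))
        ≤⟨ ℕ.+-mono-≤ (ℕ.+-mono-≤ (findK-steps n) (ℕ.≤-reflexive size))
             (ℕ.+-mono-≤
               (ℕ.+-monoˡ-≤ q (ℕ.≤-trans (plan-steps S) (ℕ.≤-reflexive (cong (ℕ._* (3 ℕ.+ n ℕ.* 2)) size))))
               (ℕ.+-mono-≤ (ℕ.≤-trans (storeAnswers-steps as)
                   (ℕ.≤-reflexive (cong (ℕ._* 3) (List.length-map _ (value (plan S))))))
                 (ℕ.≤-trans (pivot-steps S plus) (ℕ.≤-reflexive (cong (ℕ._* (3 ℕ.+ n ℕ.* 4)) size))))) ⟩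
      suc t ℕ.+ t ℕ.+ (t ℕ.* (3 ℕ.+ n ℕ.* 2) ℕ.+ q ℕ.+ (q ℕ.* 3 ℕ.+ t ℕ.* (3 ℕ.+ n ℕ.* 4)))
        ≡⟨ solve 3 (λ n t q →
             con 1 :+ t :+ t :+ (t :* (con 3 :+ n :* con 2) :+ q :+ (q :* con 3 :+ t :* (con 3 :+ n :* con 4)))
             := con 1 :+ con 8 :* t :+ con 6 :* (n :* t) :+ con 2 :* (con 2 :* q)) refl n t q ⟩
      1 ℕ.+ 8 ℕ.* t ℕ.+ 6 ℕ.* (n ℕ.* t) ℕ.+ 2 ℕ.* (2 ℕ.* q)
        ≤⟨ ℕ.+-mono-≤ (ℕ.+-mono-≤ (ℕ.+-monoʳ-≤ 1 (ℕ.*-monoʳ-≤ 8 t≤)) (ℕ.*-monoʳ-≤ 6 nt≤))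
             (ℕ.*-monoʳ-≤ 2 (2*queryCount≤ m S∈)) ⟩
      1 ℕ.+ 8 ℕ.* (2 ℕ.* h ℕ.+ 1) ℕ.+ 6 ℕ.* (2 ℕ.* h ℕ.+ 1) ℕ.+ 2 ℕ.* h
        ≡⟨ solve 1 (λ h →
             con 1 :+ con 8 :* (con 2 :* h :+ con 1) :+ con 6 :* (con 2 :* h :+ con 1) :+ con 2 :* h
             := con 15 :+ con 30 :* h) refl h ⟩
      15 ℕ.+ 30 ℕ.* h ∎
      where
      open ℕ.≤-Reasoning
      open +-*-Solver
      t = k n Q
      h = (2 ℕ.* n ℕ.∸ 1 ℕ.∸ t) ℕ.* t
      q = queryCount G Q S
      as = answers (value (plan S))
      plus = value (storeAnswers as)
      size = sample-size m S∈
      nt≤ = n*t≤ n t (k≤n n)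
      t≤ = ℕ.≤-trans (t≤n*t n t (k≤n n)) nt≤

    -- For n ≥ 1 the search for `k` costs a step however small `Q` is, so a bound proportional to
    -- `Q` needs `Q` bounded below. For n ≥ 1 the condition n ≤ Q + 1 is feasibility of t = 1; when
    -- it fails, `k` is 0 and writing out `n` singletons alone takes time that `Q` does not control.
    runTime≤ : 1ℚ ≤ Q → ∀ m S → S ∈ sampleSpace G Q m →
        ι (runTime G Q qecc-implicit S) ≤ ι 81 * Q
      × (ι n ≤ Q + 1ℚ → ι (runTime G Q qecc S) ≤ ι 81 * Q)
    runTime≤ 1≤Q m S S∈ = ℚ.≤-trans implicit≤ (ℚ.*-monoʳ-≤-nonNeg Q (ι-mono (ℕ.m≤m+n 75 6)))
                        , explicit≤
      where
      open ℚ.≤-Reasoning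
      instance _ = ℚ.pos⇒nonNeg Q
      τ h : ℕ
      τ = runTime G Q qecc-implicit S
      h = (2 ℕ.* n ℕ.∸ 1 ℕ.∸ k n Q) ℕ.* k n Q
      implicit≤ : ι τ ≤ ι 75 * Q
      implicit≤ = begin
        ι τ                               ≤⟨ ι-mono (runTime-implicit≤ m S S∈) ⟩
        ι (15 ℕ.+ 30 ℕ.* h)               ≡⟨ trans (ι-+ 15 (30 ℕ.* h)) (cong (ι 15 +_) (ι-* 30 h)) ⟩
        ι 15 + ι 30 * ι h                 ≤⟨ ℚ.+-mono-≤
          (subst (_≤ ι 15 * Q) (ℚ.*-identityʳ (ι 15)) (ℚ.*-monoˡ-≤-nonNeg (ι 15) 1≤Q))
          (ℚ.*-monoˡ-≤-nonNeg (ι 30) (pairs-through-k≤ n)) ⟩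
        ι 15 * Q + ι 30 * (ι 2 * Q)       ≡⟨ cong ((ι 15 * Q) +_) (ℚ.*-assoc (ι 30) (ι 2) Q) ⟨
        ι 15 * Q + ι 60 * Q               ≡⟨ ℚ.*-distribʳ-+ Q (ι 15) (ι 60) ⟨
        ι 75 * Q                          ∎
      plus = value (storeAnswers (answers (value (plan S))))
      explicit-steps : runTime G Q qecc S ℕ.≤ τ ℕ.+ 3 ℕ.* n
      explicit-steps = ℕ.≤-trans
        (ℕ.≤-reflexive (solve 4 (λ a b c d → a :+ (b :+ (c :+ d)) := a :+ (b :+ c) :+ d) refl
          (steps (findK n Q) ℕ.+ length S) (steps (plan {n} S) ℕ.+ queryCount G Q S)
          (steps (storeAnswers {n} (answers (value (plan S)))) ℕ.+ steps (pivot S plus))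
          (steps (singletons (value (pivot S plus))))))
        (ℕ.+-monoʳ-≤ τ (ℕ.≤-trans (singletons-steps _) (ℕ.≤-reflexive (ℕ.*-comm n 3))))
        where open +-*-Solver
      explicit≤ : ι n ≤ Q + 1ℚ → ι (runTime G Q qecc S) ≤ ι 81 * Q
      explicit≤ n≤ = begin
        ι (runTime G Q qecc S)            ≤⟨ ι-mono explicit-steps ⟩
        ι (τ ℕ.+ 3 ℕ.* n)                 ≡⟨ trans (ι-+ τ (3 ℕ.* n)) (cong (ι τ +_) (ι-* 3 n)) ⟩
        ι τ + ι 3 * ι n                   ≤⟨ ℚ.+-mono-≤ implicit≤ (ℚ.*-monoˡ-≤-nonNeg (ι 3)
                                               (ℚ.≤-trans n≤ (ℚ.+-monoʳ-≤ Q 1≤Q))) ⟩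
        ι 75 * Q + ι 3 * (Q + Q)          ≡⟨ cong ((ι 75 * Q) +_) (trans (ℚ.*-distribˡ-+ (ι 3) Q Q)
                                               (sym (ℚ.*-distribʳ-+ Q (ι 3) (ι 3)))) ⟩
        ι 75 * Q + ι 6 * Q                ≡⟨ ℚ.*-distribʳ-+ Q (ι 75) (ι 6) ⟨
        ι 81 * Q                          ∎

theorem3p4 :
    ∃ λ (C : ℕ) →
    ∀ {n : ℕ} (G : LabelledGraph n) (Q : ℚ) .{{_ : Positive Q}} →
      (∀ m S → S ∈ sampleSpace G Q m → ι (queryCount G Q S) ≤ Q)
    × (∀ opt → IsOPT G opt →
         expectedCost G Q withoutReplacement ≤ ι 3 * ι opt + slack n Q)
    × (ι 2 * Q ≤ ι (n ℕ.* (n ℕ.∸ 1)) → ∀ opt → IsOPT G opt →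
         expectedCost G Q withReplacement ≤ ι 3 * ι opt + slack n Q)
    × (1ℚ ≤ Q → ∀ m S → S ∈ sampleSpace G Q m →
           ι (runTime G Q qecc-implicit S) ≤ ι C * Q
         × (ι n ≤ Q + 1ℚ → ι (runTime G Q qecc S) ≤ ι C * Q))
-- 81 = 75 + 6: the implicit version takes at most 15 + 30 · 2Q ≤ 75Q steps, and the loop over
-- singletons adds 3n ≤ 3(Q + 1) ≤ 6Q.
theorem3p4 = 81 , λ G Q →
  queryCount≤ Q G , cost-withoutReplacement Q G , cost-withReplacement Q G , runTime≤ Q G
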